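{- Let $k\ge 0$ be an integer. Define the linear operators on symmetric functions $$CH_{1^k} = \sum_{\lambda} (-1)^{|\lambda|} e_{\lambda+1^k}\, m_\lambda^{\perp},\qquad CE_{1^k} = \sum_{\lambda} (-1)^{|\lambda|} h_{\lambda+1^k}\, f_\lambda^{\perp},$$ where the sums range over all partitions $\lambda$, with the convention $e_{\lambda+1^k}=h_{\lambda+1^k}=0$ when $l(\lambda)>k$. Then for every partition $\lambda$ with $l(\lambda)\le k$, $CH_{1^k} h_\lambda = h_{\lambda+1^k}$ and $CE_{1^k} e_\lambda = e_{\lambda+1^k}$.
   Context: $\Lambda$ is the ring of symmetric functions over $\mathbb{Q}$ with the Hall inner product, for which the monomial basis $\{m_\lambda\}$ and the homogeneous basis $\{h_\lambda\}$ are dual, and the forgotten basis $\{f_\lambda\}$ (defined by $f_\lambda=\omega(m_\lambda)$, where $\omega$ is the involution with $\omega(h_\lambda)=e_\lambda$) is dual to the elementary basis $\{e_\lambda\}$. For a symmetric function $g$, $g^\perp$ is the adjoint of multiplication by $g$ with respect to the Hall inner product. $|\lambda|$ is the size and $l(\lambda)$ the number of nonzero parts of $\lambda$. For $l(\lambda)\le k$, $\lambda+1^k$ denotes the partition $(\lambda_1+1,\ldots,\lambda_k+1)$ with $\lambda_i=0$ for $i>l(\lambda)$; thus $e_{\lambda+1^k}=\prod_{i=1}^k e_{\lambda_i+1}$ and $h_{\lambda+1^k}=\prod_{i=1}^k h_{\lambda_i+1}$. -}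

module Defs where

-- A concrete model of the ring Λ of symmetric functions over ℚ.
--
-- Conventions:
--  * An exponent vector ν = (ν₁,…,ν_r) : List ℕ denotes the monomial
--    x₁^ν₁ ⋯ x_r^ν_r in the variables x₁, x₂, ….
--  * A (formal) series is given by its coefficient function  Sym = List ℕ → ℚ ;
--    a symmetric function is such a coefficient function; two series are
--    equal (_≈_) iff all their monomial coefficients agree.
--  * Products are the literal polynomial (Cauchy) products of coefficient functions.
--  * Since {h_μ} is a basis of Λ, an element of Λ is presented by a formal
--    ℚ-combination of h_μ's (HComb); its value is  toSym.
--  * The Hall inner product is defined by ⟨h_μ , m_ν⟩ = δ_{μν}:  for H = Σ c_μ h_μ,
--    ⟨H , G⟩ = Σ c_μ · (coefficient of m_μ in G) = Σ c_μ · G μ.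

open import Data.Nat using (ℕ; zero; suc; _∸_; _≤_; _<_; _≤ᵇ_; _≡ᵇ_)
open import Data.Nat.Properties using (≤-decTotalOrder; _≟_)
open import Data.Rational using (ℚ; 0ℚ; 1ℚ; _+_; _*_; -_)
open import Data.Bool using (Bool; true; false; _∧_; if_then_else_)
open import Data.List using (List; []; _∷_; map; foldr; length; zipWith; concatMap; upTo; replicate; _++_)
open import Data.Bool.ListAction using (and)
open import Data.Nat.ListAction using (sum)
open import Data.List.Properties using (≡-dec)
open import Data.List.Relation.Unary.All using (All)
open import Data.List.Relation.Unary.Linked using (Linked)
open import Data.Product using (Σ; _×_; _,_)
open import Relation.Binary.PropositionalEquality using (_≡_)
open import Relation.Nullary.Decidable using (isYes)
open import Data.List.Sort.InsertionSort ≤-decTotalOrder using (sort)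

Sym : Set
Sym = List ℕ → ℚ

infix 4 _≈_
_≈_ : Sym → Sym → Set
F ≈ G = ∀ ν → F ν ≡ G ν

sumℚ : List ℚ → ℚ
sumℚ = foldr _+_ 0ℚ

χ : Bool → ℚ
χ true  = 1ℚ
χ false = 0ℚ

below : List ℕ → List (List ℕ)
below []      = [] ∷ []
below (n ∷ ν) = concatMap (λ a → map (a ∷_) (below ν)) (upTo (suc n))

infixl 7 _⊛_
_⊛_ : Sym → Sym → Sym
(F ⊛ G) ν = sumℚ (map (λ α → F α * G (zipWith _∸_ ν α)) (below ν))

infixl 6 _⊕_
_⊕_ : Sym → Sym → Sym
(F ⊕ G) ν = F ν + G ν

zeroS : Sym
zeroS _ = 0ℚ

sumS : List Sym → Sym
sumS = foldr _⊕_ zeroS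

scale : ℚ → Sym → Sym
scale c F ν = c * F ν

oneS : Sym
oneS ν = χ (sum ν ≡ᵇ 0)

prodS : List Sym → Sym
prodS = foldr _⊛_ oneS

nonzero : ℕ → Bool
nonzero zero    = false
nonzero (suc _) = true

filterB : {A : Set} → (A → Bool) → List A → List A
filterB p []       = []
filterB p (x ∷ xs) = if p x then x ∷ filterB p xs else filterB p xs

hS : ℕ → Sym
hS n ν = χ (sum ν ≡ᵇ n)

eS : ℕ → Sym
eS n ν = χ (and (map (_≤ᵇ 1) ν) ∧ (sum ν ≡ᵇ n))

mS : List ℕ → Sym
mS la ν = χ (isYes (≡-dec _≟_ (sort (filterB nonzero ν)) (sort (filterB nonzero la))))

hProd : List ℕ → Sym
hProd μ = prodS (map hS μ)

eProd : List ℕ → Sym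
eProd μ = prodS (map eS μ)

HComb : Set
HComb = List (ℚ × List ℕ)

toSym : HComb → Sym
toSym H ν = sumℚ (map (λ { (c , μ) → c * hProd μ ν }) H)

omegaH : HComb → Sym
omegaH H ν = sumℚ (map (λ { (c , μ) → c * eProd μ ν }) H)

inner : HComb → Sym → ℚ
inner H G = sumℚ (map (λ { (c , μ) → c * G μ }) H)

IsOmega : Sym → Sym → Set
IsOmega X Y = ∀ (H : HComb) → toSym H ≈ X → omegaH H ≈ Y

IsPerp : Sym → Sym → Sym → Set
IsPerp g F P =
  Σ HComb λ HP → (toSym HP ≈ P) ×
    (∀ (HF : HComb) → toSym HF ≈ F →
       ∀ (HG : HComb) → inner HP (toSym HG) ≡ inner HF (g ⊛ toSym HG))

IsPartition : List ℕ → Set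
IsPartition la = Linked (λ a b → b ≤ a) la × All (0 <_) la

decreasing : List ℕ → Bool
decreasing (a ∷ b ∷ r) = (b ≤ᵇ a) ∧ decreasing (b ∷ r)
decreasing _           = true

-- all partitions μ with l(μ) ≤ k and |μ| ≤ N, as zero-padded lists of length k
partsUpTo : ℕ → ℕ → List (List ℕ)
partsUpTo k N = filterB (λ μ → decreasing μ ∧ (sum μ ≤ᵇ N)) (below (replicate k N))

padTo : ℕ → List ℕ → List ℕ
padTo k la = la ++ replicate (k ∸ length la) 0

plus1k : ℕ → List ℕ → List ℕ
plus1k k la = map suc (padTo k la)

signℚ : ℕ → ℚ
signℚ zero    = 1ℚ
signℚ (suc n) = - signℚ n

-- partial sum of CH_{1^k} F over |μ| ≤ N, where P μ = m_μ^⊥ F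
-- (terms with l(μ) > k vanish by convention)
CHpartial : ℕ → ℕ → (List ℕ → Sym) → Sym
CHpartial k N P = sumS (map (λ μ → scale (signℚ (sum μ)) (eProd (map suc μ) ⊛ P μ)) (partsUpTo k N))

-- partial sum of CE_{1^k} F over |μ| ≤ N, where Q μ = f_μ^⊥ F
CEpartial : ℕ → ℕ → (List ℕ → Sym) → Sym
CEpartial k N Q = sumS (map (λ μ → scale (signℚ (sum μ)) (hProd (map suc μ) ⊛ Q μ)) (partsUpTo k N))

{-# OPTIONS --safe #-}
module Submission where

-- Reading off coefficients, m_μ^⊥ h_la = Σ_{α+β=la} [x^α]m_μ · h_β, the sum being over compositions
-- with zero parts allowed. Hence CH_{1^k} h_la = Σ_{α+β=la} (-1)^{|α|} e_{α+1^k} h_β, which factors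
-- over the k parts of la into the sums Σ_{a+b=n} (-1)^a e_{a+1} h_b = h_{n+1}.
-- For CE, adjointness moves e_la to the left of the Hall form, where ω(m_μ) has to be undone. The
-- e_κ h_ν needed there are the coefficients of products of supersymmetric complete functions, with
-- some variables bosonic and some fermionic; the expansion of e in h holds for these too, and swaps
-- bosons and fermions. That f_μ = ω(m_μ) is determined at all needs m_μ in the ℚ-span of the h_κ,
-- which follows from Newton's identities.

open import Algebra.Bundles using (CommutativeMonoid)
import Algebra.Properties.CommutativeSemigroup as CommSemigroupₚ
open import Data.Bool as Bool using (Bool; true; false; not; _∧_; if_then_else_)
open import Data.Bool.ListAction using (and)
open import Data.Empty using (⊥)
open import Data.List
  using (List; []; _∷_; map; _++_; length; concatMap; upTo; applyUpTo; zipWith; replicate)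
import Data.List.Properties as Listₚ
open import Data.List.Relation.Binary.Permutation.Propositional as Perm using (_↭_; prep; swap)
import Data.List.Relation.Binary.Permutation.Propositional.Properties as Permₚ
open import Data.List.Relation.Binary.Pointwise using (Pointwise-≡⇒≡)
open import Data.List.Relation.Unary.All as All using (All; []; _∷_)
import Data.List.Relation.Unary.All.Properties as Allₚ
open import Data.List.Relation.Unary.Linked using (Linked; []; [-]; _∷_)
open import Data.List.Relation.Unary.Sorted.TotalOrder.Properties using (↗↭↗⇒≋)
open import Data.List.Sort.Base using (module SortingAlgorithm)
import Data.List.Sort.InsertionSort as InsertionSort
open import Data.Nat as ℕ using (ℕ; zero; suc; _≤_; _∸_; _≡ᵇ_; _≤ᵇ_; z≤n; s≤s)
open import Data.Nat.ListAction using (sum)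
open import Data.Nat.ListAction.Properties using (sum-++; sum-↭)
import Data.Nat.Properties as ℕₚ
open import Data.Product using (Σ; _×_; _,_; proj₁; proj₂)
open import Data.Rational as ℚ using (ℚ; 0ℚ; 1ℚ; _+_; _*_; -_)
import Data.Rational.Properties as ℚₚ
open import Data.Rational.Solver using (module +-*-Solver)
open import Data.Sum using (_⊎_; inj₁; inj₂)
open import Data.Unit using (⊤; tt)
open import Defs
open import Function using (_∘_; const)
open import Relation.Binary.Bundles using (DecTotalOrder)
import Relation.Binary.Construct.Flip.EqAndOrd as Flip
open import Relation.Binary.PropositionalEquality
open import Relation.Nullary.Decidable using (yes; no)
open import Relation.Nullary.Negation using (contradiction)
open ≡-Reasoning

-- The Hall form is read off from a presentation of its left argument in the h_κ, while its right
-- argument is only a series. Pairing a presentation with e_κ h_ν thus sums coefficients of e_κ h_ν;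
-- counting matrices in two ways, this is the value at the exponent vector κ ++ ν of the same
-- presentation with each h_n replaced by a supersymmetric function, fermionic in the variables of
-- κ. That a presentation has the value e_la in ordinary variables says nothing direct about these
-- other values, and the tag varies with κ. So the presentation of e_la is built by a recursion
-- uniform in the tags, which makes its value known at all of them. The two operators are the two
-- constant tags of one computation: all variables bosonic for CH, all fermionic for CE. Padding la
-- with zeros to length k matches partitions with at most k parts to compositions α of length k:
-- each x^α occurs in exactly one m_μ, with coefficient 1.

private
  variable
    A B : Set

-- Finite sums

+-interchange : ∀ a b c d → (a + b) + (c + d) ≡ (a + c) + (b + d)
+-interchange = CommSemigroupₚ.interchange
  (CommutativeMonoid.commutativeSemigroup ℚₚ.+-0-commutativeMonoid)

-- Opaque, so that unification never has to invert _+_ on ℚ.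
opaque
  ∑ : List A → (A → ℚ) → ℚ
  ∑ xs f = sumℚ (map f xs)

  ∑≡sumℚ : ∀ (xs : List A) f → ∑ xs f ≡ sumℚ (map f xs)
  ∑≡sumℚ xs f = refl

  ∑-[] : ∀ (f : A → ℚ) → ∑ [] f ≡ 0ℚ
  ∑-[] f = refl

  ∑-∷ : ∀ x xs (f : A → ℚ) → ∑ (x ∷ xs) f ≡ f x + ∑ xs f
  ∑-∷ x xs f = refl

  ∑-cong : ∀ (xs : List A) {f g : A → ℚ} → (∀ x → f x ≡ g x) → ∑ xs f ≡ ∑ xs g
  ∑-cong []       f≗g = refl
  ∑-cong (x ∷ xs) f≗g = cong₂ _+_ (f≗g x) (∑-cong xs f≗g)

  ∑-cong-All : ∀ {P : A → Set} {xs} {f g : A → ℚ} → All P xs →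
               (∀ x → P x → f x ≡ g x) → ∑ xs f ≡ ∑ xs g
  ∑-cong-All []         f≗g = refl
  ∑-cong-All (px ∷ pxs) f≗g = cong₂ _+_ (f≗g _ px) (∑-cong-All pxs f≗g)

  ∑-0 : ∀ (xs : List A) → ∑ xs (λ _ → 0ℚ) ≡ 0ℚ
  ∑-0 []       = refl
  ∑-0 (x ∷ xs) = trans (ℚₚ.+-identityˡ _) (∑-0 xs)

  ∑-+ : ∀ (xs : List A) (f g : A → ℚ) → ∑ xs (λ x → f x + g x) ≡ ∑ xs f + ∑ xs g
  ∑-+ []       f g = refl
  ∑-+ (x ∷ xs) f g =
    trans (cong (f x + g x +_) (∑-+ xs f g)) (+-interchange (f x) (g x) (∑ xs f) (∑ xs g))

  ∑-*ˡ : ∀ (xs : List A) c (f : A → ℚ) → ∑ xs (λ x → c * f x) ≡ c * ∑ xs f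
  ∑-*ˡ []       c f = sym (ℚₚ.*-zeroʳ c)
  ∑-*ˡ (x ∷ xs) c f =
    trans (cong (c * f x +_) (∑-*ˡ xs c f)) (sym (ℚₚ.*-distribˡ-+ c (f x) (∑ xs f)))

  ∑-map : ∀ (h : A → B) xs (f : B → ℚ) → ∑ (map h xs) f ≡ ∑ xs (f ∘ h)
  ∑-map h xs f = cong sumℚ (sym (Listₚ.map-∘ xs))

  ∑-++ : ∀ xs ys (f : A → ℚ) → ∑ (xs ++ ys) f ≡ ∑ xs f + ∑ ys f
  ∑-++ []       ys f = sym (ℚₚ.+-identityˡ _)
  ∑-++ (x ∷ xs) ys f =
    trans (cong (f x +_) (∑-++ xs ys f)) (sym (ℚₚ.+-assoc (f x) (∑ xs f) (∑ ys f)))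

∑-singleton : ∀ x (f : A → ℚ) → ∑ (x ∷ []) f ≡ f x
∑-singleton x f = trans (∑-∷ x [] f) (trans (cong (f x +_) (∑-[] f)) (ℚₚ.+-identityʳ (f x)))

∑-zero : ∀ (xs : List A) {f : A → ℚ} → (∀ x → f x ≡ 0ℚ) → ∑ xs f ≡ 0ℚ
∑-zero xs f≗0 = trans (∑-cong xs f≗0) (∑-0 xs)

∑-*ʳ : ∀ (xs : List A) c (f : A → ℚ) → ∑ xs (λ x → f x * c) ≡ ∑ xs f * c
∑-*ʳ xs c f = begin
  ∑ xs (λ x → f x * c) ≡⟨ ∑-cong xs (λ x → ℚₚ.*-comm (f x) c) ⟩
  ∑ xs (λ x → c * f x) ≡⟨ ∑-*ˡ xs c f ⟩
  c * ∑ xs f           ≡⟨ ℚₚ.*-comm c (∑ xs f) ⟩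
  ∑ xs f * c           ∎

∑-swap : ∀ (xs : List A) (ys : List B) (f : A → B → ℚ) →
         ∑ xs (λ x → ∑ ys (f x)) ≡ ∑ ys (λ y → ∑ xs (λ x → f x y))
∑-swap []       ys f = trans (∑-[] _) (sym (∑-zero ys (λ y → ∑-[] _)))
∑-swap (x ∷ xs) ys f = begin
  ∑ (x ∷ xs) (λ x → ∑ ys (f x))               ≡⟨ ∑-∷ x xs _ ⟩
  ∑ ys (f x) + ∑ xs (λ x → ∑ ys (f x))        ≡⟨ cong (∑ ys (f x) +_) (∑-swap xs ys f) ⟩
  ∑ ys (f x) + ∑ ys (λ y → ∑ xs (λ x → f x y)) ≡⟨ sym (∑-+ ys (f x) _) ⟩
  ∑ ys (λ y → f x y + ∑ xs (λ x → f x y))     ≡⟨ ∑-cong ys (λ y → sym (∑-∷ x xs _)) ⟩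
  ∑ ys (λ y → ∑ (x ∷ xs) (λ x → f x y))       ∎

∑-concatMap : ∀ (h : A → List B) xs (f : B → ℚ) →
              ∑ (concatMap h xs) f ≡ ∑ xs (λ x → ∑ (h x) f)
∑-concatMap h []       f = trans (∑-[] f) (sym (∑-[] _))
∑-concatMap h (x ∷ xs) f = begin
  ∑ (concatMap h (x ∷ xs)) f             ≡⟨ ∑-++ (h x) (concatMap h xs) f ⟩
  ∑ (h x) f + ∑ (concatMap h xs) f       ≡⟨ cong (∑ (h x) f +_) (∑-concatMap h xs f) ⟩
  ∑ (h x) f + ∑ xs (λ x → ∑ (h x) f)     ≡⟨ sym (∑-∷ x xs _) ⟩
  ∑ (x ∷ xs) (λ x → ∑ (h x) f)           ∎

-- Sums over decompositions of a number or of an exponent vector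

-- Listing both summands instead of using `n ∸ a` turns commutativity and associativity of the
-- product into reindexings without subtraction.
antidiag : ℕ → List (ℕ × ℕ)
antidiag zero    = (0 , 0) ∷ []
antidiag (suc n) = (0 , suc n) ∷ map (λ (a , b) → suc a , b) (antidiag n)

∑-antidiag-suc : ∀ n (f : ℕ × ℕ → ℚ) →
  ∑ (antidiag (suc n)) f ≡ f (0 , suc n) + ∑ (antidiag n) (λ (a , b) → f (suc a , b))
∑-antidiag-suc n f = trans (∑-∷ _ _ f) (cong (f (0 , suc n) +_) (∑-map _ (antidiag n) f))

∑-antidiag-sucʳ : ∀ n (f : ℕ × ℕ → ℚ) →
  ∑ (antidiag (suc n)) f ≡ ∑ (antidiag n) (λ (a , b) → f (a , suc b)) + f (suc n , 0)
∑-antidiag-sucʳ zero    f = begin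
  ∑ (antidiag 1) f
    ≡⟨ ∑-antidiag-suc 0 f ⟩
  f (0 , 1) + ∑ (antidiag 0) (λ (a , b) → f (suc a , b))
    ≡⟨ cong₂ _+_ (sym (∑-singleton (0 , 0) (λ (a , b) → f (a , suc b)))) (∑-singleton (0 , 0) _) ⟩
  ∑ (antidiag 0) (λ (a , b) → f (a , suc b)) + f (1 , 0) ∎
∑-antidiag-sucʳ (suc n) f = begin
  ∑ (antidiag (suc (suc n))) f
    ≡⟨ ∑-antidiag-suc (suc n) f ⟩
  f (0 , suc (suc n)) + ∑ (antidiag (suc n)) (λ (a , b) → f (suc a , b))
    ≡⟨ cong (f (0 , suc (suc n)) +_) (∑-antidiag-sucʳ n _) ⟩
  f (0 , suc (suc n)) + (∑ (antidiag n) (λ (a , b) → f (suc a , suc b)) + f (suc (suc n) , 0))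
    ≡⟨ sym (ℚₚ.+-assoc (f (0 , suc (suc n))) _ _) ⟩
  (f (0 , suc (suc n)) + ∑ (antidiag n) (λ (a , b) → f (suc a , suc b))) + f (suc (suc n) , 0)
    ≡⟨ cong (_+ f (suc (suc n) , 0)) (sym (∑-antidiag-suc n (λ (a , b) → f (a , suc b)))) ⟩
  ∑ (antidiag (suc n)) (λ (a , b) → f (a , suc b)) + f (suc (suc n) , 0) ∎

∑-antidiag-comm : ∀ n (f : ℕ → ℕ → ℚ) →
  ∑ (antidiag n) (λ (a , b) → f a b) ≡ ∑ (antidiag n) (λ (a , b) → f b a)
∑-antidiag-comm zero    f = trans (∑-singleton (0 , 0) _) (sym (∑-singleton (0 , 0) _))
∑-antidiag-comm (suc n) f = begin
  ∑ (antidiag (suc n)) (λ (a , b) → f a b)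
    ≡⟨ ∑-antidiag-suc n _ ⟩
  f 0 (suc n) + ∑ (antidiag n) (λ (a , b) → f (suc a) b)
    ≡⟨ ℚₚ.+-comm (f 0 (suc n)) _ ⟩
  ∑ (antidiag n) (λ (a , b) → f (suc a) b) + f 0 (suc n)
    ≡⟨ cong (_+ f 0 (suc n)) (∑-antidiag-comm n (λ a b → f (suc a) b)) ⟩
  ∑ (antidiag n) (λ (a , b) → f (suc b) a) + f 0 (suc n)
    ≡⟨ sym (∑-antidiag-sucʳ n (λ (a , b) → f b a)) ⟩
  ∑ (antidiag (suc n)) (λ (a , b) → f b a) ∎

-- Both sides run over the triples with sum `n`. The triples with b = 0 are split off on each side,
-- and the rest is the induction hypothesis.
∑-antidiag-assoc : ∀ n (f : ℕ → ℕ → ℕ → ℚ) →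
  ∑ (antidiag n) (λ (a , c) → ∑ (antidiag a) (λ (b , d) → f b d c)) ≡
  ∑ (antidiag n) (λ (b , e) → ∑ (antidiag e) (λ (d , c) → f b d c))
∑-antidiag-assoc zero    f = begin
  ∑ (antidiag 0) (λ (a , c) → ∑ (antidiag a) (λ (b , d) → f b d c))
    ≡⟨ trans (∑-singleton (0 , 0) _) (∑-singleton (0 , 0) _) ⟩
  f 0 0 0
    ≡⟨ sym (trans (∑-singleton (0 , 0) _) (∑-singleton (0 , 0) _)) ⟩
  ∑ (antidiag 0) (λ (b , e) → ∑ (antidiag e) (λ (d , c) → f b d c)) ∎
∑-antidiag-assoc (suc n) f = begin
  ∑ (antidiag (suc n)) (λ (a , c) → ∑ (antidiag a) (λ (b , d) → f b d c))
    ≡⟨ ∑-antidiag-suc n _ ⟩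
  ∑ (antidiag 0) (λ (b , d) → f b d (suc n)) + ∑ (antidiag n) (λ (a , c) → ∑ (antidiag (suc a)) (λ (b , d) → f b d c))
    ≡⟨ cong₂ _+_ (∑-singleton (0 , 0) _)
         (∑-cong (antidiag n) (λ (a , c) → ∑-antidiag-suc a (λ (b , d) → f b d c))) ⟩
  f 0 0 (suc n) + ∑ (antidiag n) (λ (a , c) → f 0 (suc a) c + ∑ (antidiag a) (λ (b , d) → f (suc b) d c))
    ≡⟨ cong (f 0 0 (suc n) +_) (∑-+ (antidiag n) _ _) ⟩
  f 0 0 (suc n) + (∑ (antidiag n) (λ (a , c) → f 0 (suc a) c)
    + ∑ (antidiag n) (λ (a , c) → ∑ (antidiag a) (λ (b , d) → f (suc b) d c)))
    ≡⟨ sym (ℚₚ.+-assoc (f 0 0 (suc n)) _ _) ⟩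
  (f 0 0 (suc n) + ∑ (antidiag n) (λ (a , c) → f 0 (suc a) c))
    + ∑ (antidiag n) (λ (a , c) → ∑ (antidiag a) (λ (b , d) → f (suc b) d c))
    ≡⟨ cong₂ _+_ (sym (∑-antidiag-suc n (λ (d , c) → f 0 d c))) (∑-antidiag-assoc n (f ∘ suc)) ⟩
  ∑ (antidiag (suc n)) (λ (d , c) → f 0 d c)
    + ∑ (antidiag n) (λ (b , e) → ∑ (antidiag e) (λ (d , c) → f (suc b) d c))
    ≡⟨ sym (∑-antidiag-suc n _) ⟩
  ∑ (antidiag (suc n)) (λ (b , e) → ∑ (antidiag e) (λ (d , c) → f b d c)) ∎

antidiag-sum : ∀ n → All (λ (a , b) → a ℕ.+ b ≡ n) (antidiag n)
antidiag-sum zero    = refl ∷ []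
antidiag-sum (suc n) = refl ∷ Allₚ.map⁺ (All.map (cong suc) (antidiag-sum n))

∑-upTo : ∀ n (f : ℕ → ℕ → ℚ) →
  ∑ (upTo (suc n)) (λ a → f a (n ∸ a)) ≡ ∑ (antidiag n) (λ (a , b) → f a b)
∑-upTo zero    f = trans (∑-singleton 0 _) (sym (∑-singleton (0 , 0) _))
∑-upTo (suc n) f = begin
  ∑ (upTo (suc (suc n))) (λ a → f a (suc n ∸ a))
    ≡⟨ ∑-∷ 0 (applyUpTo suc (suc n)) _ ⟩
  f 0 (suc n) + ∑ (applyUpTo suc (suc n)) (λ a → f a (suc n ∸ a))
    ≡⟨ cong (λ xs → f 0 (suc n) + ∑ xs (λ a → f a (suc n ∸ a))) (sym (Listₚ.map-upTo suc (suc n))) ⟩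
  f 0 (suc n) + ∑ (map suc (upTo (suc n))) (λ a → f a (suc n ∸ a))
    ≡⟨ cong (f 0 (suc n) +_) (trans (∑-map suc (upTo (suc n)) _) (∑-upTo n (f ∘ suc))) ⟩
  f 0 (suc n) + ∑ (antidiag n) (λ (a , b) → f (suc a) b)
    ≡⟨ sym (∑-antidiag-suc n _) ⟩
  ∑ (antidiag (suc n)) (λ (a , b) → f a b) ∎

splits : List ℕ → List (List ℕ × List ℕ)
splits []      = ([] , []) ∷ []
splits (n ∷ ν) =
  concatMap (λ (a , b) → map (λ (α , β) → a ∷ α , b ∷ β) (splits ν)) (antidiag n)

∑-splits-∷ : ∀ n ν (f : List ℕ × List ℕ → ℚ) →
  ∑ (splits (n ∷ ν)) f ≡
  ∑ (antidiag n) (λ (a , b) → ∑ (splits ν) (λ (α , β) → f (a ∷ α , b ∷ β)))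
∑-splits-∷ n ν f = trans (∑-concatMap _ (antidiag n) f)
  (∑-cong (antidiag n) (λ _ → ∑-map _ (splits ν) f))

∑-splits-comm : ∀ ν (f : List ℕ → List ℕ → ℚ) →
  ∑ (splits ν) (λ (α , β) → f α β) ≡ ∑ (splits ν) (λ (α , β) → f β α)
∑-splits-comm []      f = trans (∑-singleton ([] , []) _) (sym (∑-singleton ([] , []) _))
∑-splits-comm (n ∷ ν) f = begin
  ∑ (splits (n ∷ ν)) (λ (α , β) → f α β)
    ≡⟨ ∑-splits-∷ n ν _ ⟩
  ∑ (antidiag n) (λ (a , b) → ∑ (splits ν) (λ (α , β) → f (a ∷ α) (b ∷ β)))
    ≡⟨ ∑-antidiag-comm n (λ a b → ∑ (splits ν) (λ (α , β) → f (a ∷ α) (b ∷ β))) ⟩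
  ∑ (antidiag n) (λ (a , b) → ∑ (splits ν) (λ (α , β) → f (b ∷ α) (a ∷ β)))
    ≡⟨ ∑-cong (antidiag n) (λ (a , b) → ∑-splits-comm ν (λ α β → f (b ∷ α) (a ∷ β))) ⟩
  ∑ (antidiag n) (λ (a , b) → ∑ (splits ν) (λ (α , β) → f (b ∷ β) (a ∷ α)))
    ≡⟨ sym (∑-splits-∷ n ν _) ⟩
  ∑ (splits (n ∷ ν)) (λ (α , β) → f β α) ∎

∑-splits-assoc : ∀ ν (f : List ℕ → List ℕ → List ℕ → ℚ) →
  ∑ (splits ν) (λ (α , γ) → ∑ (splits α) (λ (β , δ) → f β δ γ)) ≡
  ∑ (splits ν) (λ (β , ε) → ∑ (splits ε) (λ (δ , γ) → f β δ γ))
∑-splits-assoc []      f = begin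
  ∑ (splits []) (λ (α , γ) → ∑ (splits α) (λ (β , δ) → f β δ γ))
    ≡⟨ trans (∑-singleton ([] , []) _) (∑-singleton ([] , []) _) ⟩
  f [] [] []
    ≡⟨ sym (trans (∑-singleton ([] , []) _) (∑-singleton ([] , []) _)) ⟩
  ∑ (splits []) (λ (β , ε) → ∑ (splits ε) (λ (δ , γ) → f β δ γ)) ∎
∑-splits-assoc (n ∷ ν) f = begin
  ∑ (splits (n ∷ ν)) (λ (α , γ) → ∑ (splits α) (λ (β , δ) → f β δ γ))
    ≡⟨ ∑-splits-∷ n ν _ ⟩
  ∑ (antidiag n) (λ (a , c) → ∑ (splits ν) (λ (α , γ) →
    ∑ (splits (a ∷ α)) (λ (β , δ) → f β δ (c ∷ γ))))
    ≡⟨ ∑-cong (antidiag n) (λ (a , c) → trans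
         (∑-cong (splits ν) (λ (α , γ) → ∑-splits-∷ a α _))
         (∑-swap (splits ν) (antidiag a) _)) ⟩
  ∑ (antidiag n) (λ (a , c) → ∑ (antidiag a) (λ (b , d) →
    ∑ (splits ν) (λ (α , γ) → ∑ (splits α) (λ (β , δ) → f (b ∷ β) (d ∷ δ) (c ∷ γ)))))
    ≡⟨ ∑-antidiag-assoc n (λ b d c →
         ∑ (splits ν) (λ (α , γ) → ∑ (splits α) (λ (β , δ) → f (b ∷ β) (d ∷ δ) (c ∷ γ)))) ⟩
  ∑ (antidiag n) (λ (b , e) → ∑ (antidiag e) (λ (d , c) →
    ∑ (splits ν) (λ (α , γ) → ∑ (splits α) (λ (β , δ) → f (b ∷ β) (d ∷ δ) (c ∷ γ)))))
    ≡⟨ ∑-cong (antidiag n) (λ (b , e) → ∑-cong (antidiag e) (λ (d , c) →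
         ∑-splits-assoc ν (λ β δ γ → f (b ∷ β) (d ∷ δ) (c ∷ γ)))) ⟩
  ∑ (antidiag n) (λ (b , e) → ∑ (antidiag e) (λ (d , c) →
    ∑ (splits ν) (λ (β , ε) → ∑ (splits ε) (λ (δ , γ) → f (b ∷ β) (d ∷ δ) (c ∷ γ)))))
    ≡⟨ ∑-cong (antidiag n) (λ (b , e) → sym (trans
         (∑-cong (splits ν) (λ (β , ε) → ∑-splits-∷ e ε _))
         (∑-swap (splits ν) (antidiag e) _))) ⟩
  ∑ (antidiag n) (λ (b , e) → ∑ (splits ν) (λ (β , ε) →
    ∑ (splits (e ∷ ε)) (λ (δ , γ) → f (b ∷ β) δ γ)))
    ≡⟨ sym (∑-splits-∷ n ν _) ⟩
  ∑ (splits (n ∷ ν)) (λ (β , ε) → ∑ (splits ε) (λ (δ , γ) → f β δ γ)) ∎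

IsSplit : List ℕ → List ℕ × List ℕ → Set
IsSplit ν (α , β) = length α ≡ length ν × sum α ℕ.+ sum β ≡ sum ν

splits-IsSplit : ∀ ν → All (IsSplit ν) (splits ν)
splits-IsSplit []      = (refl , refl) ∷ []
splits-IsSplit (n ∷ ν) = Allₚ.concat⁺ (Allₚ.map⁺ (All.map
  (λ {(a , b)} a+b≡n → Allₚ.map⁺ (All.map
    (λ {(α , β)} (l , s) → cong suc l ,
      trans (ℕ-interchange a (sum α) b (sum β)) (cong₂ ℕ._+_ a+b≡n s))
    (splits-IsSplit ν)))
  (antidiag-sum n)))
  where
  ℕ-interchange = CommSemigroupₚ.interchange ℕₚ.+-commutativeSemigroup

∑-below : ∀ ν (f : List ℕ → List ℕ → ℚ) →
  ∑ (below ν) (λ α → f α (zipWith _∸_ ν α)) ≡ ∑ (splits ν) (λ (α , β) → f α β)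
∑-below []      f = trans (∑-singleton [] _) (sym (∑-singleton ([] , []) _))
∑-below (n ∷ ν) f = begin
  ∑ (below (n ∷ ν)) (λ α → f α (zipWith _∸_ (n ∷ ν) α))
    ≡⟨ ∑-concatMap (λ a → map (a ∷_) (below ν)) (upTo (suc n)) _ ⟩
  ∑ (upTo (suc n)) (λ a → ∑ (map (a ∷_) (below ν)) (λ α → f α (zipWith _∸_ (n ∷ ν) α)))
    ≡⟨ ∑-cong (upTo (suc n)) (λ a → trans (∑-map (a ∷_) (below ν) _)
         (∑-below ν (λ α β → f (a ∷ α) (n ∸ a ∷ β)))) ⟩
  ∑ (upTo (suc n)) (λ a → ∑ (splits ν) (λ (α , β) → f (a ∷ α) (n ∸ a ∷ β)))
    ≡⟨ ∑-upTo n (λ a b → ∑ (splits ν) (λ (α , β) → f (a ∷ α) (b ∷ β))) ⟩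
  ∑ (antidiag n) (λ (a , b) → ∑ (splits ν) (λ (α , β) → f (a ∷ α) (b ∷ β)))
    ≡⟨ sym (∑-splits-∷ n ν _) ⟩
  ∑ (splits (n ∷ ν)) (λ (α , β) → f α β) ∎

-- The algebra of series

⊛-splits : ∀ F G ν → (F ⊛ G) ν ≡ ∑ (splits ν) (λ (α , β) → F α * G β)
⊛-splits F G ν = trans (sym (∑≡sumℚ (below ν) _)) (∑-below ν (λ α β → F α * G β))

infixl 8 _∂_
_∂_ : Sym → ℕ → Sym
(F ∂ a) ν = F (a ∷ ν)

-- The Cauchy product in the first variable alone, `F ∂ a` being the coefficient of x₁^a. Inductions
-- on the exponent vector go through this.
⊛-∷ : ∀ F G n ν → (F ⊛ G) (n ∷ ν) ≡ ∑ (antidiag n) (λ (a , b) → (F ∂ a ⊛ G ∂ b) ν)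
⊛-∷ F G n ν = begin
  (F ⊛ G) (n ∷ ν)
    ≡⟨ ⊛-splits F G (n ∷ ν) ⟩
  ∑ (splits (n ∷ ν)) (λ (α , β) → F α * G β)
    ≡⟨ ∑-splits-∷ n ν _ ⟩
  ∑ (antidiag n) (λ (a , b) → ∑ (splits ν) (λ (α , β) → F (a ∷ α) * G (b ∷ β)))
    ≡⟨ ∑-cong (antidiag n) (λ (a , b) → sym (⊛-splits (F ∂ a) (G ∂ b) ν)) ⟩
  ∑ (antidiag n) (λ (a , b) → (F ∂ a ⊛ G ∂ b) ν) ∎

⊛-[] : ∀ F G → (F ⊛ G) [] ≡ F [] * G []
⊛-[] F G = ℚₚ.+-identityʳ (F [] * G [])

≈-refl : ∀ {F} → F ≈ F
≈-refl ν = refl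

⊛-cong : ∀ {F F′ G G′} → F ≈ F′ → G ≈ G′ → F ⊛ G ≈ F′ ⊛ G′
⊛-cong {F} {F′} {G} {G′} F≈F′ G≈G′ ν = begin
  (F ⊛ G) ν                              ≡⟨ ⊛-splits F G ν ⟩
  ∑ (splits ν) (λ (α , β) → F α * G β)   ≡⟨ ∑-cong (splits ν) (λ (α , β) → cong₂ _*_ (F≈F′ α) (G≈G′ β)) ⟩
  ∑ (splits ν) (λ (α , β) → F′ α * G′ β) ≡⟨ sym (⊛-splits F′ G′ ν) ⟩
  (F′ ⊛ G′) ν                            ∎

⊛-comm : ∀ F G → F ⊛ G ≈ G ⊛ F
⊛-comm F G ν = begin
  (F ⊛ G) ν                                ≡⟨ ⊛-splits F G ν ⟩
  ∑ (splits ν) (λ (α , β) → F α * G β) ≡⟨ ∑-splits-comm ν (λ α β → F α * G β) ⟩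
  ∑ (splits ν) (λ (α , β) → F β * G α) ≡⟨ ∑-cong (splits ν) (λ (α , β) → ℚₚ.*-comm (F β) (G α)) ⟩
  ∑ (splits ν) (λ (α , β) → G α * F β) ≡⟨ sym (⊛-splits G F ν) ⟩
  (G ⊛ F) ν                                ∎

⊛-assoc : ∀ F G H → (F ⊛ G) ⊛ H ≈ F ⊛ (G ⊛ H)
⊛-assoc F G H ν = begin
  ((F ⊛ G) ⊛ H) ν
    ≡⟨ ⊛-splits (F ⊛ G) H ν ⟩
  ∑ (splits ν) (λ (α , γ) → (F ⊛ G) α * H γ)
    ≡⟨ ∑-cong (splits ν) (λ (α , γ) → trans (cong (_* H γ) (⊛-splits F G α))
         (sym (∑-*ʳ (splits α) (H γ) (λ (β , δ) → F β * G δ)))) ⟩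
  ∑ (splits ν) (λ (α , γ) → ∑ (splits α) (λ (β , δ) → F β * G δ * H γ))
    ≡⟨ ∑-splits-assoc ν (λ β δ γ → F β * G δ * H γ) ⟩
  ∑ (splits ν) (λ (β , ε) → ∑ (splits ε) (λ (δ , γ) → F β * G δ * H γ))
    ≡⟨ ∑-cong (splits ν) (λ (β , ε) → trans
         (∑-cong (splits ε) (λ (δ , γ) → ℚₚ.*-assoc (F β) (G δ) (H γ)))
         (trans (∑-*ˡ (splits ε) (F β) _) (cong (F β *_) (sym (⊛-splits G H ε))))) ⟩
  ∑ (splits ν) (λ (β , ε) → F β * (G ⊛ H) ε)
    ≡⟨ sym (⊛-splits F (G ⊛ H) ν) ⟩
  (F ⊛ (G ⊛ H)) ν ∎

⊛-∑ˡ : ∀ (xs : List A) (F : A → Sym) G ν →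
       ((λ ρ → ∑ xs (λ x → F x ρ)) ⊛ G) ν ≡ ∑ xs (λ x → (F x ⊛ G) ν)
⊛-∑ˡ xs F G ν = begin
  ((λ ρ → ∑ xs (λ x → F x ρ)) ⊛ G) ν
    ≡⟨ ⊛-splits (λ ρ → ∑ xs (λ x → F x ρ)) G ν ⟩
  ∑ (splits ν) (λ (α , β) → ∑ xs (λ x → F x α) * G β)
    ≡⟨ ∑-cong (splits ν) (λ (α , β) → sym (∑-*ʳ xs (G β) (λ x → F x α))) ⟩
  ∑ (splits ν) (λ (α , β) → ∑ xs (λ x → F x α * G β))
    ≡⟨ ∑-swap (splits ν) xs _ ⟩
  ∑ xs (λ x → ∑ (splits ν) (λ (α , β) → F x α * G β))
    ≡⟨ ∑-cong xs (λ x → sym (⊛-splits (F x) G ν)) ⟩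
  ∑ xs (λ x → (F x ⊛ G) ν) ∎

⊛-∑ʳ : ∀ (xs : List A) F (G : A → Sym) ν →
       (F ⊛ (λ ρ → ∑ xs (λ x → G x ρ))) ν ≡ ∑ xs (λ x → (F ⊛ G x) ν)
⊛-∑ʳ xs F G ν = trans (⊛-comm F (λ ρ → ∑ xs (λ x → G x ρ)) ν)
  (trans (⊛-∑ˡ xs G F ν) (∑-cong xs (λ x → ⊛-comm (G x) F ν)))

⊛-scaleˡ : ∀ c F G → scale c F ⊛ G ≈ scale c (F ⊛ G)
⊛-scaleˡ c F G ν = begin
  (scale c F ⊛ G) ν
    ≡⟨ ⊛-splits (scale c F) G ν ⟩
  ∑ (splits ν) (λ (α , β) → c * F α * G β)
    ≡⟨ ∑-cong (splits ν) (λ (α , β) → ℚₚ.*-assoc c (F α) (G β)) ⟩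
  ∑ (splits ν) (λ (α , β) → c * (F α * G β))
    ≡⟨ ∑-*ˡ (splits ν) c _ ⟩
  c * ∑ (splits ν) (λ (α , β) → F α * G β)
    ≡⟨ cong (c *_) (sym (⊛-splits F G ν)) ⟩
  c * (F ⊛ G) ν ∎

⊛-scaleʳ : ∀ c F G → F ⊛ scale c G ≈ scale c (F ⊛ G)
⊛-scaleʳ c F G ν = trans (⊛-comm F (scale c G) ν)
  (trans (⊛-scaleˡ c G F ν) (cong (c *_) (⊛-comm G F ν)))

⊛-zeroˡ : ∀ {F} → F ≈ zeroS → ∀ G → F ⊛ G ≈ zeroS
⊛-zeroˡ {F} F≈0 G ν = trans (⊛-splits F G ν) (∑-zero (splits ν) (λ (α , β) →
  trans (cong (_* G β) (F≈0 α)) (ℚₚ.*-zeroˡ (G β))))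

⊛-identityˡ : ∀ F → oneS ⊛ F ≈ F
⊛-identityˡ F []      = trans (⊛-[] oneS F) (ℚₚ.*-identityˡ (F []))
⊛-identityˡ F (n ∷ ν) = trans (⊛-∷ oneS F n ν) (go n)
  where
  go : ∀ n → ∑ (antidiag n) (λ (a , b) → (oneS ∂ a ⊛ F ∂ b) ν) ≡ F (n ∷ ν)
  go zero    = trans (∑-singleton (0 , 0) _) (⊛-identityˡ (F ∂ 0) ν)
  go (suc n) = begin
    ∑ (antidiag (suc n)) (λ (a , b) → (oneS ∂ a ⊛ F ∂ b) ν)
      ≡⟨ ∑-antidiag-suc n _ ⟩
    (oneS ⊛ F ∂ suc n) ν + ∑ (antidiag n) (λ (a , b) → (zeroS ⊛ F ∂ b) ν)
      ≡⟨ cong₂ _+_ (⊛-identityˡ (F ∂ suc n) ν)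
           (∑-zero (antidiag n) (λ (a , b) → ⊛-zeroˡ {zeroS} (λ _ → refl) (F ∂ b) ν)) ⟩
    F (suc n ∷ ν) + 0ℚ
      ≡⟨ ℚₚ.+-identityʳ _ ⟩
    F (suc n ∷ ν) ∎

⊛-commutativeMonoid : CommutativeMonoid _ _
⊛-commutativeMonoid = record
  { Carrier = Sym
  ; _≈_     = _≈_
  ; _∙_     = _⊛_
  ; ε       = oneS
  ; isCommutativeMonoid = record
    { isMonoid = record
      { isSemigroup = record
        { isMagma = record
          { isEquivalence = record
            { refl  = ≈-refl
            ; sym   = λ F≈G ν → sym (F≈G ν)
            ; trans = λ F≈G G≈H ν → trans (F≈G ν) (G≈H ν)
            }
          ; ∙-cong = ⊛-cong
          }
        ; assoc = ⊛-assoc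
        }
      ; identity = ⊛-identityˡ , λ F ν → trans (⊛-comm F oneS ν) (⊛-identityˡ F ν)
      }
    ; comm = ⊛-comm
    }
  }

module ⊛ = CommutativeMonoid ⊛-commutativeMonoid
module ⊛ₚ = CommSemigroupₚ ⊛.commutativeSemigroup

module *ₚ = CommSemigroupₚ (CommutativeMonoid.commutativeSemigroup ℚₚ.*-1-commutativeMonoid)

∑-product : ∀ (xs : List A) (ys : List B) (f : A → ℚ) (g : B → ℚ) →
            ∑ xs (λ x → ∑ ys (λ y → f x * g y)) ≡ ∑ xs f * ∑ ys g
∑-product xs ys f g =
  trans (∑-cong xs (λ x → ∑-*ˡ ys (f x) g)) (∑-*ʳ xs (∑ ys g) f)

χ-∧ : ∀ p q → χ (p ∧ q) ≡ χ p * χ q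
χ-∧ true  q = sym (ℚₚ.*-identityˡ (χ q))
χ-∧ false q = sym (ℚₚ.*-zeroˡ (χ q))

-- Only the pair (p , q) can contribute, and it lies on the antidiagonal exactly when p + q = n.
∑-antidiag-χ : ∀ n p q →
  ∑ (antidiag n) (λ (i , j) → χ (p ≡ᵇ i) * χ (q ≡ᵇ j)) ≡ χ (p ℕ.+ q ≡ᵇ n)
∑-antidiag-χ zero zero q = trans (∑-singleton (0 , 0) _) (ℚₚ.*-identityˡ _)
∑-antidiag-χ zero (suc p) q = trans (∑-singleton (0 , 0) _) (ℚₚ.*-zeroˡ (χ (q ≡ᵇ 0)))
∑-antidiag-χ (suc n) zero q = trans (∑-antidiag-suc n _)
  (trans (cong₂ _+_ (ℚₚ.*-identityˡ (χ (q ≡ᵇ suc n)))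
           (∑-zero (antidiag n) (λ (_ , j) → ℚₚ.*-zeroˡ (χ (q ≡ᵇ j)))))
    (ℚₚ.+-identityʳ _))
∑-antidiag-χ (suc n) (suc p) q = trans (∑-antidiag-suc n _)
  (trans (cong₂ _+_ (ℚₚ.*-zeroˡ (χ (q ≡ᵇ suc n))) (∑-antidiag-χ n p q)) (ℚₚ.+-identityˡ _))

-- Supersymmetric complete functions

-- A tag s : ℕ → Bool says which variables are fermionic: gS s n is the coefficient of t^n in
-- ∏_{s i false} 1/(1 - xᵢ t) · ∏_{s i true} (1 + xᵢ t).
weight : Bool → ℕ → ℚ
weight true (suc (suc _)) = 0ℚ
weight _    _             = 1ℚ

weights : (ℕ → Bool) → List ℕ → ℚ
weights s []      = 1ℚ
weights s (n ∷ ν) = weight (s 0) n * weights (s ∘ suc) ν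

gS : (ℕ → Bool) → ℕ → Sym
gS s n ν = weights s ν * χ (sum ν ≡ᵇ n)

gProd : (ℕ → Bool) → List ℕ → Sym
gProd s ρ = prodS (map (gS s) ρ)

weight-true : ∀ n → weight true n ≡ χ (n ≤ᵇ 1)
weight-true zero          = refl
weight-true (suc zero)    = refl
weight-true (suc (suc n)) = refl

weights-false : ∀ ν → weights (const false) ν ≡ 1ℚ
weights-false []      = refl
weights-false (n ∷ ν) = trans (ℚₚ.*-identityˡ _) (weights-false ν)

weights-true : ∀ ν → weights (const true) ν ≡ χ (and (map (_≤ᵇ 1) ν))
weights-true []      = refl
weights-true (n ∷ ν) = trans (cong₂ _*_ (weight-true n) (weights-true ν)) (sym (χ-∧ (n ≤ᵇ 1) _))

gS-false : ∀ n → gS (const false) n ≈ hS n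
gS-false n ν = trans (cong (_* χ (sum ν ≡ᵇ n)) (weights-false ν)) (ℚₚ.*-identityˡ _)

gS-true : ∀ n → gS (const true) n ≈ eS n
gS-true n ν = trans (cong (_* χ (sum ν ≡ᵇ n)) (weights-true ν)) (sym (χ-∧ (and (map (_≤ᵇ 1) ν)) (sum ν ≡ᵇ n)))

prodS-cong : ∀ {F G : ℕ → Sym} → (∀ n → F n ≈ G n) → ∀ μ → prodS (map F μ) ≈ prodS (map G μ)
prodS-cong F≈G []      = ≈-refl
prodS-cong F≈G (n ∷ μ) = ⊛-cong (F≈G n) (prodS-cong F≈G μ)

gProd-false : ∀ μ → gProd (const false) μ ≈ hProd μ
gProd-false = prodS-cong gS-false

gProd-true : ∀ μ → gProd (const true) μ ≈ eProd μ
gProd-true = prodS-cong gS-true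

oneS-∷ : ∀ n ν → oneS (n ∷ ν) ≡ χ (n ≡ᵇ 0) * oneS ν
oneS-∷ zero    ν = sym (ℚₚ.*-identityˡ (oneS ν))
oneS-∷ (suc n) ν = sym (ℚₚ.*-zeroˡ (oneS ν))

weight-0 : ∀ b → weight b 0 ≡ 1ℚ
weight-0 true  = refl
weight-0 false = refl

gS-0 : ∀ s → gS s 0 ≈ oneS
gS-0 s []            = refl
gS-0 s (zero ∷ ν)    = trans
  (cong (λ w → w * weights (s ∘ suc) ν * χ (sum ν ≡ᵇ 0)) (weight-0 (s 0)))
  (trans (cong (_* χ (sum ν ≡ᵇ 0)) (ℚₚ.*-identityˡ (weights (s ∘ suc) ν))) (gS-0 (s ∘ suc) ν))
gS-0 s (suc n ∷ ν)   = ℚₚ.*-zeroʳ (weights s (suc n ∷ ν))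

signℚ-+ : ∀ m n → signℚ (m ℕ.+ n) ≡ signℚ m * signℚ n
signℚ-+ zero    n = sym (ℚₚ.*-identityˡ (signℚ n))
signℚ-+ (suc m) n = trans (cong -_ (signℚ-+ m n)) (ℚₚ.neg-distribˡ-* (signℚ m) (signℚ n))

∑-neg : ∀ (xs : List A) (f : A → ℚ) → ∑ xs (λ x → - f x) ≡ - ∑ xs f
∑-neg []       f = trans (∑-[] _) (cong -_ (sym (∑-[] f)))
∑-neg (x ∷ xs) f = trans (∑-∷ x xs _) (trans (cong (- f x +_) (∑-neg xs f))
  (trans (sym (ℚₚ.neg-distrib-+ (f x) (∑ xs f))) (cong -_ (sym (∑-∷ x xs f)))))

-- In one variable the two weights have the generating functions 1/(1 - x) and 1 + x, so this is (1
-- - x) · 1/(1 - x) = 1 or 1/(1 + x) · (1 + x) = 1. The factor with only two terms decides from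
-- which end the sum is peeled.
alternating-weight : ∀ b n →
  ∑ (antidiag n) (λ (i , j) → signℚ i * (weight (not b) i * weight b j)) ≡ χ (n ≡ᵇ 0)
alternating-weight b zero = trans (∑-singleton (0 , 0) _) (val b)
  where
  val : ∀ b → 1ℚ * (weight (not b) 0 * weight b 0) ≡ 1ℚ
  val true = refl
  val false = refl
alternating-weight b (suc zero) =
  trans (∑-antidiag-suc 0 _) (trans (cong (f +_) (∑-singleton (0 , 0) _)) (val b))
  where
  f = signℚ 0 * (weight (not b) 0 * weight b 1)
  val : ∀ b → signℚ 0 * (weight (not b) 0 * weight b 1) +
              signℚ 1 * (weight (not b) 1 * weight b 0) ≡ 0ℚ
  val true = refl
  val false = refl
alternating-weight false (suc (suc n)) = begin
  ∑ (antidiag (suc (suc n))) f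
    ≡⟨ ∑-antidiag-suc (suc n) f ⟩
  1ℚ + ∑ (antidiag (suc n)) (λ (i , j) → f (suc i , j))
    ≡⟨ cong (1ℚ +_) (∑-antidiag-suc n (λ (i , j) → f (suc i , j))) ⟩
  1ℚ + (- 1ℚ + ∑ (antidiag n) (λ (i , j) → f (suc (suc i) , j)))
    ≡⟨ cong (λ x → 1ℚ + (- 1ℚ + x))
         (∑-zero (antidiag n) (λ (i , j) → ℚₚ.*-zeroʳ (signℚ (suc (suc i))))) ⟩
  0ℚ ∎
  where
  f : ℕ × ℕ → ℚ
  f (i , j) = signℚ i * (weight true i * weight false j)
alternating-weight true (suc (suc n)) = begin
  ∑ (antidiag (suc (suc n))) f
    ≡⟨ ∑-antidiag-sucʳ (suc n) f ⟩
  ∑ (antidiag (suc n)) (λ (i , j) → f (i , suc j)) + f (suc (suc n) , 0)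
    ≡⟨ cong (_+ f (suc (suc n) , 0)) (∑-antidiag-sucʳ n (λ (i , j) → f (i , suc j))) ⟩
  (∑ (antidiag n) (λ (i , j) → f (i , suc (suc j))) + f (suc n , 1)) + f (suc (suc n) , 0)
    ≡⟨ cong (λ x → (x + f (suc n , 1)) + f (suc (suc n) , 0))
         (∑-zero (antidiag n) (λ (i , j) → ℚₚ.*-zeroʳ (signℚ i))) ⟩
  (0ℚ + signℚ (suc n) * 1ℚ) + - signℚ (suc n) * 1ℚ
    ≡⟨ cong₂ _+_ (trans (ℚₚ.+-identityˡ _) (ℚₚ.*-identityʳ (signℚ (suc n)))) (ℚₚ.*-identityʳ (- signℚ (suc n))) ⟩
  signℚ (suc n) + - signℚ (suc n)
    ≡⟨ ℚₚ.+-inverseʳ (signℚ (suc n)) ⟩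
  0ℚ ∎
  where
  f : ℕ × ℕ → ℚ
  f (i , j) = signℚ i * (weight false i * weight true j)

sign-weights-∷ : ∀ σ τ u v x y → σ * τ * (u * x * (v * y)) ≡ σ * (u * v) * (τ * (x * y))
sign-weights-∷ = solve 6 (λ σ τ u v x y →
  σ :* τ :* (u :* x :* (v :* y)) := σ :* (u :* v) :* (τ :* (x :* y))) refl
  where open +-*-Solver

alternating-weights : ∀ s ν →
  ∑ (splits ν) (λ (α , β) → signℚ (sum α) * (weights (not ∘ s) α * weights s β)) ≡ oneS ν
alternating-weights s []      = ∑-singleton ([] , []) _
alternating-weights s (n ∷ ν) = begin
  ∑ (splits (n ∷ ν)) (λ (α , β) → signℚ (sum α) * (weights (not ∘ s) α * weights s β))
    ≡⟨ ∑-splits-∷ n ν _ ⟩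
  ∑ (antidiag n) (λ (a , b) → ∑ (splits ν) (λ (α , β) →
    signℚ (a ℕ.+ sum α) * (weights (not ∘ s) (a ∷ α) * weights s (b ∷ β))))
    ≡⟨ ∑-cong (antidiag n) (λ (a , b) → ∑-cong (splits ν) (λ (α , β) →
         trans (cong (_* (weights (not ∘ s) (a ∷ α) * weights s (b ∷ β))) (signℚ-+ a (sum α)))
           (sign-weights-∷ (signℚ a) (signℚ (sum α)) (weight (not (s 0)) a) (weight (s 0) b)
              (weights (not ∘ s ∘ suc) α) (weights (s ∘ suc) β)))) ⟩
  ∑ (antidiag n) (λ (a , b) → ∑ (splits ν) (λ (α , β) →
    signℚ a * (weight (not (s 0)) a * weight (s 0) b) *
    (signℚ (sum α) * (weights (not ∘ s ∘ suc) α * weights (s ∘ suc) β))))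
    ≡⟨ ∑-product (antidiag n) (splits ν) _ _ ⟩
  _
    ≡⟨ cong₂ _*_ (alternating-weight (s 0) n) (alternating-weights (s ∘ suc) ν) ⟩
  χ (n ≡ᵇ 0) * oneS ν
    ≡⟨ sym (oneS-∷ n ν) ⟩
  oneS (n ∷ ν) ∎

f-χ : ∀ (f : ℕ → ℚ) m n → f m * χ (m ≡ᵇ n) ≡ f n * χ (m ≡ᵇ n)
f-χ f zero    zero    = refl
f-χ f zero    (suc n) = trans (ℚₚ.*-zeroʳ (f 0)) (sym (ℚₚ.*-zeroʳ (f (suc n))))
f-χ f (suc m) zero    = trans (ℚₚ.*-zeroʳ (f (suc m))) (sym (ℚₚ.*-zeroʳ (f 0)))
f-χ f (suc m) (suc n) = f-χ (f ∘ suc) m n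

-- A graded convolution is an ungraded one restricted to the right degree.
∑-antidiag-graded : ∀ n ν (c : ℕ → ℚ) (u v : List ℕ → ℚ) →
  (∀ p i → c i * χ (p ≡ᵇ i) ≡ c p * χ (p ≡ᵇ i)) →
  ∑ (antidiag n) (λ (i , j) → c i *
    ((λ α → u α * χ (sum α ≡ᵇ i)) ⊛ (λ β → v β * χ (sum β ≡ᵇ j))) ν) ≡
  ∑ (splits ν) (λ (α , β) → c (sum α) * (u α * v β)) * χ (sum ν ≡ᵇ n)
∑-antidiag-graded n ν c u v c-χ = begin
  ∑ (antidiag n) (λ (i , j) → c i *
    ((λ α → u α * χ (sum α ≡ᵇ i)) ⊛ (λ β → v β * χ (sum β ≡ᵇ j))) ν)
    ≡⟨ ∑-cong (antidiag n) (λ (i , j) →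
         trans (cong (c i *_) (⊛-splits (λ α → u α * χ (sum α ≡ᵇ i)) (λ β → v β * χ (sum β ≡ᵇ j)) ν))
           (sym (∑-*ˡ (splits ν) (c i) _))) ⟩
  ∑ (antidiag n) (λ (i , j) → ∑ (splits ν) (λ (α , β) →
    c i * (u α * χ (sum α ≡ᵇ i) * (v β * χ (sum β ≡ᵇ j)))))
    ≡⟨ ∑-swap (antidiag n) (splits ν) _ ⟩
  ∑ (splits ν) (λ (α , β) → ∑ (antidiag n) (λ (i , j) →
    c i * (u α * χ (sum α ≡ᵇ i) * (v β * χ (sum β ≡ᵇ j)))))
    ≡⟨ ∑-cong-All (splits-IsSplit ν) (λ (α , β) (_ , |α|+|β|≡|ν|) → begin
         ∑ (antidiag n) (λ (i , j) → c i * (u α * χ (sum α ≡ᵇ i) * (v β * χ (sum β ≡ᵇ j))))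
           ≡⟨ ∑-cong (antidiag n) (λ (i , j) → term α β i j) ⟩
         ∑ (antidiag n) (λ (i , j) →
           c (sum α) * (u α * v β) * (χ (sum α ≡ᵇ i) * χ (sum β ≡ᵇ j)))
           ≡⟨ ∑-*ˡ (antidiag n) (c (sum α) * (u α * v β)) _ ⟩
         c (sum α) * (u α * v β) * ∑ (antidiag n) (λ (i , j) → χ (sum α ≡ᵇ i) * χ (sum β ≡ᵇ j))
           ≡⟨ cong (c (sum α) * (u α * v β) *_) (trans (∑-antidiag-χ n (sum α) (sum β))
                (cong (λ m → χ (m ≡ᵇ n)) |α|+|β|≡|ν|)) ⟩
         c (sum α) * (u α * v β) * χ (sum ν ≡ᵇ n) ∎) ⟩
  ∑ (splits ν) (λ (α , β) → c (sum α) * (u α * v β) * χ (sum ν ≡ᵇ n))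
    ≡⟨ ∑-*ʳ (splits ν) (χ (sum ν ≡ᵇ n)) (λ (α , β) → c (sum α) * (u α * v β)) ⟩
  ∑ (splits ν) (λ (α , β) → c (sum α) * (u α * v β)) * χ (sum ν ≡ᵇ n) ∎
  where
  shuffle : ∀ c u x v y → c * (u * x * (v * y)) ≡ c * x * (u * v * y)
  shuffle = solve 5 (λ c u x v y → c :* (u :* x :* (v :* y)) := c :* x :* (u :* v :* y)) refl
    where open +-*-Solver
  unshuffle : ∀ c u x v y → c * x * (u * v * y) ≡ c * (u * v) * (x * y)
  unshuffle = solve 5 (λ c u x v y → c :* x :* (u :* v :* y) := c :* (u :* v) :* (x :* y)) refl
    where open +-*-Solver
  term : ∀ α β i j → c i * (u α * χ (sum α ≡ᵇ i) * (v β * χ (sum β ≡ᵇ j))) ≡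
                     c (sum α) * (u α * v β) * (χ (sum α ≡ᵇ i) * χ (sum β ≡ᵇ j))
  term α β i j = begin
    c i * (u α * χ (sum α ≡ᵇ i) * (v β * χ (sum β ≡ᵇ j)))
      ≡⟨ shuffle (c i) (u α) (χ (sum α ≡ᵇ i)) (v β) (χ (sum β ≡ᵇ j)) ⟩
    c i * χ (sum α ≡ᵇ i) * (u α * v β * χ (sum β ≡ᵇ j))
      ≡⟨ cong (_* (u α * v β * χ (sum β ≡ᵇ j))) (c-χ (sum α) i) ⟩
    c (sum α) * χ (sum α ≡ᵇ i) * (u α * v β * χ (sum β ≡ᵇ j))
      ≡⟨ unshuffle (c (sum α)) (u α) (χ (sum α ≡ᵇ i)) (v β) (χ (sum β ≡ᵇ j)) ⟩
    c (sum α) * (u α * v β) * (χ (sum α ≡ᵇ i) * χ (sum β ≡ᵇ j)) ∎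

oneS-χ : ∀ n ν → oneS ν * χ (sum ν ≡ᵇ n) ≡ oneS ν * χ (0 ≡ᵇ n)
oneS-χ n ν = go (sum ν)
  where
  go : ∀ m → χ (m ≡ᵇ 0) * χ (m ≡ᵇ n) ≡ χ (m ≡ᵇ 0) * χ (0 ≡ᵇ n)
  go zero    = refl
  go (suc m) = trans (ℚₚ.*-zeroˡ (χ (suc m ≡ᵇ n))) (sym (ℚₚ.*-zeroˡ (χ (0 ≡ᵇ n))))

-- The supersymmetric form of Σ (-1)^i e_i h_{n-i} = δ_{n,0}, obtained by multiplying the
-- one-variable identities and cutting out degree `n`.
alternating-gS : ∀ s n ν →
  ∑ (antidiag n) (λ (i , j) → signℚ i * (gS (not ∘ s) i ⊛ gS s j) ν) ≡ oneS ν * χ (0 ≡ᵇ n)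
alternating-gS s n ν = begin
  _ ≡⟨ ∑-antidiag-graded n ν signℚ (weights (not ∘ s)) (weights s) (λ p i → sym (f-χ signℚ p i)) ⟩
  _ ≡⟨ cong (_* χ (sum ν ≡ᵇ n)) (alternating-weights s ν) ⟩
  oneS ν * χ (sum ν ≡ᵇ n) ≡⟨ oneS-χ n ν ⟩
  oneS ν * χ (0 ≡ᵇ n) ∎

+≡0⇒≡ : ∀ {x y} → x + - y ≡ 0ℚ → x ≡ y
+≡0⇒≡ {x} {y} p = begin
  x               ≡⟨ sym (ℚₚ.+-identityʳ x) ⟩
  x + 0ℚ          ≡⟨ cong (x +_) (sym (ℚₚ.+-inverseˡ y)) ⟩
  x + (- y + y)   ≡⟨ sym (ℚₚ.+-assoc x (- y) y) ⟩
  (x + - y) + y   ≡⟨ cong (_+ y) p ⟩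
  0ℚ + y          ≡⟨ ℚₚ.+-identityˡ y ⟩
  y               ∎

-- In `alternating-gS` for degree n + 1 the term i = 0 is `gS s (suc n)` itself; the other terms are
-- moved across, which shifts their index and flips their sign.
gS-suc : ∀ s n ν →
  gS s (suc n) ν ≡ ∑ (antidiag n) (λ (i , j) → signℚ i * (gS (not ∘ s) (suc i) ⊛ gS s j) ν)
gS-suc s n ν = +≡0⇒≡ (begin
  gS s (suc n) ν + - ∑ (antidiag n) (λ (i , j) → signℚ i * G i j)
    ≡⟨ cong₂ _+_ (sym head) (sym (trans
         (∑-cong (antidiag n) (λ (i , j) → sym (ℚₚ.neg-distribˡ-* (signℚ i) (G i j))))
         (∑-neg (antidiag n) _))) ⟩
  1ℚ * (gS (not ∘ s) 0 ⊛ gS s (suc n)) ν + ∑ (antidiag n) (λ (i , j) → - signℚ i * G i j)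
    ≡⟨ sym (∑-antidiag-suc n (λ (i , j) → signℚ i * (gS (not ∘ s) i ⊛ gS s j) ν)) ⟩
  ∑ (antidiag (suc n)) (λ (i , j) → signℚ i * (gS (not ∘ s) i ⊛ gS s j) ν)
    ≡⟨ alternating-gS s (suc n) ν ⟩
  oneS ν * 0ℚ
    ≡⟨ ℚₚ.*-zeroʳ (oneS ν) ⟩
  0ℚ ∎)
  where
  G : ℕ → ℕ → ℚ
  G i j = (gS (not ∘ s) (suc i) ⊛ gS s j) ν
  head : 1ℚ * (gS (not ∘ s) 0 ⊛ gS s (suc n)) ν ≡ gS s (suc n) ν
  head = trans (ℚₚ.*-identityˡ ((gS (not ∘ s) 0 ⊛ gS s (suc n)) ν))
    (trans (⊛-cong (gS-0 (not ∘ s)) (≈-refl {gS s (suc n)}) ν) (⊛-identityˡ (gS s (suc n)) ν))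

-- The product of the instances of `gS-suc` for the entries of `la`, multiplied out. The tag
-- `const false` gives what CH needs and `const true` what CE needs.
gProd-suc : ∀ s la ν →
  ∑ (splits la) (λ (α , β) → signℚ (sum α) * (gProd (not ∘ s) (map suc α) ⊛ gProd s β) ν) ≡
  gProd s (map suc la) ν
gProd-suc s []       ν = trans (∑-singleton ([] , []) _)
  (trans (ℚₚ.*-identityˡ ((oneS ⊛ oneS) ν)) (⊛-identityˡ oneS ν))
gProd-suc s (n ∷ la) ν = begin
  ∑ (splits (n ∷ la)) (λ (α , β) → signℚ (sum α) * (gProd (not ∘ s) (map suc α) ⊛ gProd s β) ν)
    ≡⟨ ∑-splits-∷ n la _ ⟩
  ∑ (antidiag n) (λ (a , b) → ∑ (splits la) (λ (α , β) →
    signℚ (a ℕ.+ sum α) * ((gS (not ∘ s) (suc a) ⊛ X α) ⊛ (gS s b ⊛ gProd s β)) ν))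
    ≡⟨ ∑-cong (antidiag n) (λ (a , b) → trans
         (∑-cong (splits la) (λ (α , β) → term a b α β))
         (sym (⊛-∑ʳ (splits la) (U a b) (λ (α , β) → V α β) ν))) ⟩
  ∑ (antidiag n) (λ (a , b) → (U a b ⊛ (λ ρ → ∑ (splits la) (λ (α , β) → V α β ρ))) ν)
    ≡⟨ sym (⊛-∑ˡ (antidiag n) (λ (a , b) → U a b) (λ ρ → ∑ (splits la) (λ (α , β) → V α β ρ)) ν) ⟩
  ((λ ρ → ∑ (antidiag n) (λ (a , b) → U a b ρ)) ⊛
   (λ ρ → ∑ (splits la) (λ (α , β) → V α β ρ))) ν
    ≡⟨ ⊛-cong (λ ρ → sym (gS-suc s n ρ)) (gProd-suc s la) ν ⟩
  gProd s (map suc (n ∷ la)) ν ∎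
  where
  X : List ℕ → Sym
  X α = gProd (not ∘ s) (map suc α)
  U : ℕ → ℕ → Sym
  U a b = scale (signℚ a) (gS (not ∘ s) (suc a) ⊛ gS s b)
  V : List ℕ → List ℕ → Sym
  V α β = scale (signℚ (sum α)) (X α ⊛ gProd s β)
  term : ∀ a b α β →
    signℚ (a ℕ.+ sum α) * ((gS (not ∘ s) (suc a) ⊛ X α) ⊛ (gS s b ⊛ gProd s β)) ν ≡
    (U a b ⊛ V α β) ν
  term a b α β = begin
    signℚ (a ℕ.+ sum α) * ((gS (not ∘ s) (suc a) ⊛ X α) ⊛ (gS s b ⊛ gProd s β)) ν
      ≡⟨ cong₂ _*_ (signℚ-+ a (sum α))
           (⊛ₚ.interchange (gS (not ∘ s) (suc a)) (X α) (gS s b) (gProd s β) ν) ⟩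
    signℚ a * signℚ (sum α) * (F ⊛ G) ν
      ≡⟨ ℚₚ.*-assoc (signℚ a) (signℚ (sum α)) ((F ⊛ G) ν) ⟩
    signℚ a * (signℚ (sum α) * (F ⊛ G) ν)
      ≡⟨ cong (signℚ a *_) (sym (⊛-scaleʳ (signℚ (sum α)) F G ν)) ⟩
    signℚ a * (F ⊛ V α β) ν
      ≡⟨ sym (⊛-scaleˡ (signℚ a) F (V α β) ν) ⟩
    (U a b ⊛ V α β) ν ∎
    where
    F = gS (not ∘ s) (suc a) ⊛ gS s b
    G = X α ⊛ gProd s β

-- Counting matrices by rows and by columns

tagged : Bool → ℕ → Sym
tagged false = hS
tagged true  = eS

-- The tags sit on the factors, each an h or an e, whereas in `gProd` they sit on the variables.
rows : (ℕ → Bool) → List ℕ → Sym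
rows s []      = oneS
rows s (n ∷ ν) = tagged (s 0) n ⊛ rows (s ∘ suc) ν

-- Only a = i survives: the coefficient of x₁^i is h_{n-i} in h_n, and in e_n it is e_{n-i} for i ≤
-- 1 and zero beyond. Written as a sum over all pairs, the formula also covers i > n.
tagged-∂ : ∀ b n i ρ → tagged b n (i ∷ ρ) ≡
  ∑ (antidiag n) (λ (a , c) → χ (a ≡ᵇ i) * (weight b a * tagged b c ρ))
tagged-∂ b zero i ρ = trans (val b i) (sym (∑-singleton (0 , 0) _))
  where
  val : ∀ b i → tagged b 0 (i ∷ ρ) ≡ χ (0 ≡ᵇ i) * (weight b 0 * tagged b 0 ρ)
  val false zero    = sym (trans (ℚₚ.*-identityˡ _) (ℚₚ.*-identityˡ (hS 0 ρ)))
  val false (suc i) = sym (ℚₚ.*-zeroˡ (1ℚ * hS 0 ρ))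
  val true  zero    = sym (trans (ℚₚ.*-identityˡ _) (ℚₚ.*-identityˡ (eS 0 ρ)))
  val true  (suc zero) = trans (trans (χ-∧ (and (map (_≤ᵇ 1) ρ)) false) (ℚₚ.*-zeroʳ (χ (and (map (_≤ᵇ 1) ρ)))))
    (sym (ℚₚ.*-zeroˡ (1ℚ * eS 0 ρ)))
  val true  (suc (suc i)) = sym (ℚₚ.*-zeroˡ (1ℚ * eS 0 ρ))
tagged-∂ b (suc n) i ρ = trans (val b i) (sym (∑-antidiag-suc n _))
  where
  X : Bool → ℕ → ℚ
  X b i = ∑ (antidiag n) (λ (a , c) → χ (suc a ≡ᵇ i) * (weight b (suc a) * tagged b c ρ))
  val : ∀ b i → tagged b (suc n) (i ∷ ρ) ≡ χ (0 ≡ᵇ i) * (weight b 0 * tagged b (suc n) ρ) + X b i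
  val b zero = sym (begin
    1ℚ * (weight b 0 * tagged b (suc n) ρ) + X b 0
      ≡⟨ cong₂ _+_ (ℚₚ.*-identityˡ (weight b 0 * tagged b (suc n) ρ))
           (∑-zero (antidiag n) (λ (a , c) → ℚₚ.*-zeroˡ (weight b (suc a) * tagged b c ρ))) ⟩
    weight b 0 * tagged b (suc n) ρ + 0ℚ
      ≡⟨ ℚₚ.+-identityʳ _ ⟩
    weight b 0 * tagged b (suc n) ρ
      ≡⟨ cong (_* tagged b (suc n) ρ) (weight-0 b) ⟩
    1ℚ * tagged b (suc n) ρ
      ≡⟨ ℚₚ.*-identityˡ _ ⟩
    tagged b (suc n) ρ
      ≡⟨ tagged-0∷ b ⟩
    tagged b (suc n) (0 ∷ ρ) ∎)
    where
    tagged-0∷ : ∀ b → tagged b (suc n) ρ ≡ tagged b (suc n) (0 ∷ ρ)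
    tagged-0∷ false = refl
    tagged-0∷ true  = refl
  val false (suc i) = trans (tagged-∂ false n i ρ) (sym (trans
    (cong (_+ X false (suc i)) (ℚₚ.*-zeroˡ (1ℚ * hS (suc n) ρ))) (ℚₚ.+-identityˡ _)))
  val true (suc i) = sym (trans
    (cong (_+ X true (suc i)) (ℚₚ.*-zeroˡ (1ℚ * eS (suc n) ρ))) (trans (ℚₚ.+-identityˡ _) (tail n i)))
    where
    tail : ∀ n i → ∑ (antidiag n) (λ (a , c) → χ (a ≡ᵇ i) * (weight true (suc a) * eS c ρ)) ≡
                   eS (suc n) (suc i ∷ ρ)
    tail zero zero = trans (∑-singleton (0 , 0) _) (trans (ℚₚ.*-identityˡ _) (ℚₚ.*-identityˡ (eS 0 ρ)))
    tail (suc n) zero = trans (∑-antidiag-suc n _) (trans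
      (cong₂ _+_ (trans (ℚₚ.*-identityˡ _) (ℚₚ.*-identityˡ (eS (suc n) ρ)))
        (∑-zero (antidiag n) (λ (a , c) → ℚₚ.*-zeroˡ (0ℚ * eS c ρ))))
      (ℚₚ.+-identityʳ _))
    tail zero (suc i) = trans (∑-singleton (0 , 0) _) (ℚₚ.*-zeroˡ (1ℚ * eS 0 ρ))
    tail (suc n) (suc i) = trans (∑-antidiag-suc n _) (trans
      (cong₂ _+_ (ℚₚ.*-zeroˡ (1ℚ * eS (suc n) ρ))
        (∑-zero (antidiag n) (λ (a , c) →
          trans (cong (χ (a ≡ᵇ i) *_) (ℚₚ.*-zeroˡ (eS c ρ))) (ℚₚ.*-zeroʳ (χ (a ≡ᵇ i))))))
      (ℚₚ.+-identityʳ 0ℚ))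

-- Here `α` is the first column of the matrix, with sum `m`, and `β` is what it leaves of the row
-- sums.
rows-∷ : ∀ s ν m ρ → rows s ν (m ∷ ρ) ≡ ∑ (splits ν) (λ (α , β) → gS s m α * rows s β ρ)
rows-∷ s []      m ρ = sym (trans (∑-singleton ([] , []) _) (val m))
  where
  val : ∀ m → gS s m [] * oneS ρ ≡ oneS (m ∷ ρ)
  val zero    = ℚₚ.*-identityˡ (oneS ρ)
  val (suc m) = ℚₚ.*-zeroˡ (oneS ρ)
rows-∷ s (n ∷ ν) m ρ = begin
  rows s (n ∷ ν) (m ∷ ρ)
    ≡⟨ ⊛-∷ (tagged (s 0) n) (rows (s ∘ suc) ν) m ρ ⟩
  ∑ (antidiag m) (λ (i , j) → (tagged (s 0) n ∂ i ⊛ rows (s ∘ suc) ν ∂ j) ρ)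
    ≡⟨ ∑-cong (antidiag m) (λ (i , j) → begin
         (tagged (s 0) n ∂ i ⊛ rows (s ∘ suc) ν ∂ j) ρ
           ≡⟨ ⊛-cong (tagged-∂ (s 0) n i) (rows-∷ (s ∘ suc) ν j) ρ ⟩
         ((λ ρ → ∑ (antidiag n) (λ (a , c) → T i a c ρ)) ⊛
          (λ ρ → ∑ (splits ν) (λ (α , β) → R j α β ρ))) ρ
           ≡⟨ ⊛-∑ˡ (antidiag n) (λ (a , c) → T i a c) (λ ρ → ∑ (splits ν) (λ (α , β) → R j α β ρ)) ρ ⟩
         ∑ (antidiag n) (λ (a , c) → (T i a c ⊛ (λ ρ → ∑ (splits ν) (λ (α , β) → R j α β ρ))) ρ)
           ≡⟨ ∑-cong (antidiag n) (λ (a , c) → ⊛-∑ʳ (splits ν) (T i a c) (λ (α , β) → R j α β) ρ) ⟩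
         ∑ (antidiag n) (λ (a , c) → ∑ (splits ν) (λ (α , β) → (T i a c ⊛ R j α β) ρ)) ∎) ⟩
  ∑ (antidiag m) (λ (i , j) → ∑ (antidiag n) (λ (a , c) → ∑ (splits ν) (λ (α , β) → (T i a c ⊛ R j α β) ρ)))
    ≡⟨ trans (∑-swap (antidiag m) (antidiag n) _)
         (∑-cong (antidiag n) (λ (a , c) → ∑-swap (antidiag m) (splits ν) _)) ⟩
  ∑ (antidiag n) (λ (a , c) → ∑ (splits ν) (λ (α , β) → ∑ (antidiag m) (λ (i , j) → (T i a c ⊛ R j α β) ρ)))
    ≡⟨ ∑-cong (antidiag n) (λ (a , c) → ∑-cong (splits ν) (λ (α , β) → collect a c α β)) ⟩
  ∑ (antidiag n) (λ (a , c) → ∑ (splits ν) (λ (α , β) → gS s m (a ∷ α) * rows s (c ∷ β) ρ))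
    ≡⟨ sym (∑-splits-∷ n ν _) ⟩
  ∑ (splits (n ∷ ν)) (λ (α , β) → gS s m α * rows s β ρ) ∎
  where
  T : ℕ → ℕ → ℕ → Sym
  T i a c ρ = χ (a ≡ᵇ i) * (weight (s 0) a * tagged (s 0) c ρ)
  R : ℕ → List ℕ → List ℕ → Sym
  R j α β ρ = gS (s ∘ suc) j α * rows (s ∘ suc) β ρ
  shuffle : ∀ x w u y z → x * (w * (u * y * z)) ≡ w * u * z * (x * y)
  shuffle = solve 5 (λ x w u y z → x :* (w :* (u :* y :* z)) := w :* u :* z :* (x :* y)) refl
    where open +-*-Solver
  collect : ∀ a c α β → ∑ (antidiag m) (λ (i , j) → (T i a c ⊛ R j α β) ρ) ≡
                        gS s m (a ∷ α) * rows s (c ∷ β) ρ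
  collect a c α β = begin
    ∑ (antidiag m) (λ (i , j) → (T i a c ⊛ R j α β) ρ)
      ≡⟨ ∑-cong (antidiag m) (λ (i , j) → begin
           (T i a c ⊛ R j α β) ρ
             ≡⟨ ⊛-scaleˡ (χ (a ≡ᵇ i)) (scale w t) (R j α β) ρ ⟩
           χ (a ≡ᵇ i) * (scale w t ⊛ R j α β) ρ
             ≡⟨ cong (χ (a ≡ᵇ i) *_) (⊛-scaleˡ w t (R j α β) ρ) ⟩
           χ (a ≡ᵇ i) * (w * (t ⊛ R j α β) ρ)
             ≡⟨ cong (λ x → χ (a ≡ᵇ i) * (w * x)) (⊛-scaleʳ (gS (s ∘ suc) j α) t r ρ) ⟩
           χ (a ≡ᵇ i) * (w * (u * χ (sum α ≡ᵇ j) * z))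
             ≡⟨ shuffle (χ (a ≡ᵇ i)) w u (χ (sum α ≡ᵇ j)) z ⟩
           w * u * z * (χ (a ≡ᵇ i) * χ (sum α ≡ᵇ j)) ∎) ⟩
    ∑ (antidiag m) (λ (i , j) → w * u * z * (χ (a ≡ᵇ i) * χ (sum α ≡ᵇ j)))
      ≡⟨ ∑-*ˡ (antidiag m) (w * u * z) _ ⟩
    w * u * z * ∑ (antidiag m) (λ (i , j) → χ (a ≡ᵇ i) * χ (sum α ≡ᵇ j))
      ≡⟨ cong (w * u * z *_) (∑-antidiag-χ m a (sum α)) ⟩
    w * u * z * χ (a ℕ.+ sum α ≡ᵇ m)
      ≡⟨ *ₚ.xy∙z≈xz∙y (w * u) z (χ (a ℕ.+ sum α ≡ᵇ m)) ⟩
    gS s m (a ∷ α) * rows s (c ∷ β) ρ ∎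
    where
    w = weight (s 0) a
    u = weights (s ∘ suc) α
    t = tagged (s 0) c
    r = rows (s ∘ suc) β
    z = (t ⊛ r) ρ

rows-[] : ∀ s ν → rows s ν [] ≡ oneS ν
rows-[] s []      = refl
rows-[] s (n ∷ ν) = trans (⊛-[] (tagged (s 0) n) (rows (s ∘ suc) ν))
  (trans (cong₂ _*_ (val (s 0) n) (rows-[] (s ∘ suc) ν)) (sym (oneS-∷ n ν)))
  where
  val : ∀ b n → tagged b n [] ≡ χ (n ≡ᵇ 0)
  val false zero    = refl
  val false (suc n) = refl
  val true  zero    = refl
  val true  (suc n) = refl

-- Both sides count nonnegative integer matrices with row sums ν and column sums ρ whose tagged
-- rows have entries 0 or 1.
gProd-rows : ∀ s ρ ν → gProd s ρ ν ≡ rows s ν ρ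
gProd-rows s []      ν = sym (rows-[] s ν)
gProd-rows s (m ∷ ρ) ν = begin
  gProd s (m ∷ ρ) ν
    ≡⟨ ⊛-splits (gS s m) (gProd s ρ) ν ⟩
  ∑ (splits ν) (λ (α , β) → gS s m α * gProd s ρ β)
    ≡⟨ ∑-cong (splits ν) (λ (α , β) → cong (gS s m α *_) (gProd-rows s ρ β)) ⟩
  ∑ (splits ν) (λ (α , β) → gS s m α * rows s β ρ)
    ≡⟨ sym (rows-∷ s ν m ρ) ⟩
  rows s ν (m ∷ ρ) ∎

rows-false : ∀ ν → rows (const false) ν ≈ hProd ν
rows-false []      = ≈-refl
rows-false (n ∷ ν) = ⊛-cong (≈-refl {hS n}) (rows-false ν)

rows-true : ∀ ν → rows (const true) ν ≈ eProd ν
rows-true []      = ≈-refl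
rows-true (n ∷ ν) = ⊛-cong (≈-refl {eS n}) (rows-true ν)

-- Under a constant tag all entries of the matrix obey the same condition, so transposition
-- exchanges row sums and column sums.
gProd-const-comm : ∀ b μ ν → gProd (const b) μ ν ≡ gProd (const b) ν μ
gProd-const-comm false μ ν =
  trans (gProd-rows (const false) μ ν) (trans (rows-false ν μ) (sym (gProd-false ν μ)))
gProd-const-comm true μ ν =
  trans (gProd-rows (const true) μ ν) (trans (rows-true ν μ) (sym (gProd-true ν μ)))

weights-cong : ∀ {s t} → (∀ i → s i ≡ t i) → ∀ ν → weights s ν ≡ weights t ν
weights-cong s≗t []      = refl
weights-cong s≗t (n ∷ ν) =
  cong₂ _*_ (cong (λ b → weight b n) (s≗t 0)) (weights-cong (s≗t ∘ suc) ν)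

gS-cong : ∀ {s t} → (∀ i → s i ≡ t i) → ∀ n → gS s n ≈ gS t n
gS-cong s≗t n ν = cong (_* χ (sum ν ≡ᵇ n)) (weights-cong s≗t ν)

-- Combinations of the h_κ and their specialisations

evalS : (ℕ → Bool) → HComb → Sym
evalS s H ν = ∑ H (λ (c , κ) → c * gProd s κ ν)

scaleH : ℚ → HComb → HComb
scaleH c = map (λ (d , κ) → c * d , κ)

mulH : HComb → HComb → HComb
mulH H K = concatMap (λ (c , κ) → map (λ (d , ρ) → c * d , κ ++ ρ) K) H

gProd-++ : ∀ s κ ρ → gProd s (κ ++ ρ) ≈ gProd s κ ⊛ gProd s ρ
gProd-++ s []      ρ ν = sym (⊛-identityˡ (gProd s ρ) ν)
gProd-++ s (n ∷ κ) ρ ν = trans (⊛-cong (≈-refl {gS s n}) (gProd-++ s κ ρ) ν)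
  (sym (⊛-assoc (gS s n) (gProd s κ) (gProd s ρ) ν))

evalS-scaleH : ∀ s c H → evalS s (scaleH c H) ≈ scale c (evalS s H)
evalS-scaleH s c H ν = trans (∑-map _ H _)
  (trans (∑-cong H (λ (d , κ) → ℚₚ.*-assoc c d (gProd s κ ν))) (∑-*ˡ H c _))

evalS-mulH : ∀ s H K → evalS s (mulH H K) ≈ evalS s H ⊛ evalS s K
evalS-mulH s H K ν = begin
  evalS s (mulH H K) ν
    ≡⟨ ∑-concatMap _ H _ ⟩
  ∑ H (λ (c , κ) → ∑ (map (λ (d , ρ) → c * d , κ ++ ρ) K) (λ (c , κ) → c * gProd s κ ν))
    ≡⟨ ∑-cong H (λ (c , κ) → trans (∑-map _ K _) (∑-cong K (λ (d , ρ) → term c κ d ρ))) ⟩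
  ∑ H (λ (c , κ) → ∑ K (λ (d , ρ) → (scale c (gProd s κ) ⊛ scale d (gProd s ρ)) ν))
    ≡⟨ ∑-cong H (λ (c , κ) →
         sym (⊛-∑ʳ K (scale c (gProd s κ)) (λ (d , ρ) → scale d (gProd s ρ)) ν)) ⟩
  ∑ H (λ (c , κ) → (scale c (gProd s κ) ⊛ evalS s K) ν)
    ≡⟨ sym (⊛-∑ˡ H (λ (c , κ) → scale c (gProd s κ)) (evalS s K) ν) ⟩
  (evalS s H ⊛ evalS s K) ν ∎
  where
  term : ∀ c κ d ρ → c * d * gProd s (κ ++ ρ) ν ≡ (scale c (gProd s κ) ⊛ scale d (gProd s ρ)) ν
  term c κ d ρ = begin
    c * d * gProd s (κ ++ ρ) ν
      ≡⟨ cong (c * d *_) (gProd-++ s κ ρ ν) ⟩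
    c * d * (gProd s κ ⊛ gProd s ρ) ν
      ≡⟨ ℚₚ.*-assoc c d _ ⟩
    c * (d * (gProd s κ ⊛ gProd s ρ) ν)
      ≡⟨ cong (c *_) (sym (⊛-scaleʳ d (gProd s κ) (gProd s ρ) ν)) ⟩
    c * (gProd s κ ⊛ scale d (gProd s ρ)) ν
      ≡⟨ sym (⊛-scaleˡ c (gProd s κ) (scale d (gProd s ρ)) ν) ⟩
    (scale c (gProd s κ) ⊛ scale d (gProd s ρ)) ν ∎

-- Combinations of the h_κ whose specialisations along a family of tags are prescribed: with a
-- single tag this is the ℚ-span of the h_κ, with all tags it pins down the combination itself.
module Span {I : Set} (tag : I → ℕ → Bool) where

  Spanned : (I → Sym) → Set
  Spanned F = Σ HComb λ H → ∀ i → evalS (tag i) H ≈ F i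

  spanned-cong : ∀ {F G} → (∀ i → F i ≈ G i) → Spanned F → Spanned G
  spanned-cong F≈G (H , H≈F) = H , λ i ν → trans (H≈F i ν) (F≈G i ν)

  spanned-gProd : ∀ κ → Spanned (λ i → gProd (tag i) κ)
  spanned-gProd κ = (1ℚ , κ) ∷ [] , λ i ν → trans (∑-singleton (1ℚ , κ) _) (ℚₚ.*-identityˡ _)

  spanned-gS : ∀ n → Spanned (λ i → gS (tag i) n)
  spanned-gS n = spanned-cong
    (λ i ν → trans (⊛-comm (gS (tag i) n) oneS ν) (⊛-identityˡ (gS (tag i) n) ν))
    (spanned-gProd (n ∷ []))

  spanned-scale : ∀ c {F} → Spanned F → Spanned (λ i → scale c (F i))
  spanned-scale c (H , H≈F) = scaleH c H ,
    λ i ν → trans (evalS-scaleH (tag i) c H ν) (cong (c *_) (H≈F i ν))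

  spanned-⊕ : ∀ {F G} → Spanned F → Spanned G → Spanned (λ i → F i ⊕ G i)
  spanned-⊕ (H , H≈F) (K , K≈G) = H ++ K ,
    λ i ν → trans (∑-++ H K _) (cong₂ _+_ (H≈F i ν) (K≈G i ν))

  spanned-⊛ : ∀ {F G} → Spanned F → Spanned G → Spanned (λ i → F i ⊛ G i)
  spanned-⊛ (H , H≈F) (K , K≈G) = mulH H K ,
    λ i ν → trans (evalS-mulH (tag i) H K ν) (⊛-cong (H≈F i) (K≈G i) ν)

  -- The side condition `P` carries to each summand the degree or length bound on which the later
  -- recursions rest.
  spanned-∑ : ∀ {P : A → Set} {xs} {F : A → I → Sym} → All P xs →
    (∀ x → P x → Spanned (F x)) → Spanned (λ i ν → ∑ xs (λ x → F x i ν))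
  spanned-∑ []         F-spanned = [] , λ i ν → trans (∑-[] _) (sym (∑-[] _))
  spanned-∑ (px ∷ pxs) F-spanned = spanned-cong (λ i ν → sym (∑-∷ _ _ _))
    (spanned-⊕ (F-spanned _ px) (spanned-∑ pxs F-spanned))

-- Expansions in the h_κ of the transpose

module _ where
  open Span {ℕ → Bool} (λ s → s)

  -- `gS-suc` for the transposed tag expresses degree n + 1 through untransposed functions and
  -- transposed ones of degree at most n. Its coefficients do not depend on `s`, so a single
  -- combination serves all tags. The bound `N` makes the descent to an arbitrary smaller degree
  -- structural.
  spanned-transpose-gS : ∀ n → Spanned (λ s → gS (not ∘ s) n)
  spanned-transpose-gS n = go n n ℕₚ.≤-refl
    where
    not-not : ∀ b → not (not b) ≡ b
    not-not true  = refl
    not-not false = refl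
    go : ∀ N n → n ≤ N → Spanned (λ s → gS (not ∘ s) n)
    go N zero n≤N = spanned-cong (λ s ν → sym (gS-0 (not ∘ s) ν)) (spanned-gProd [])
    go (suc N) (suc n) (s≤s n≤N) = spanned-cong (λ s ν → sym (gS-suc (not ∘ s) n ν))
      (spanned-∑ (antidiag-sum n) (λ (i , j) i+j≡n → spanned-scale (signℚ i) (spanned-⊛
        -- Double transposition gives back `s` only pointwise, hence the passage through `gS-cong`.
        (spanned-cong (λ s ν → sym (gS-cong (λ k → not-not (s k)) (suc i) ν)) (spanned-gS (suc i)))
        (go N j (ℕₚ.≤-trans (ℕₚ.≤-trans (ℕₚ.m≤n+m j i) (ℕₚ.≤-reflexive i+j≡n)) n≤N)))))

  spanned-transpose-gProd : ∀ la → Spanned (λ s → gProd (not ∘ s) la)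
  spanned-transpose-gProd []       = spanned-gProd []
  spanned-transpose-gProd (n ∷ la) = spanned-⊛ (spanned-transpose-gS n) (spanned-transpose-gProd la)

  -- An expansion of e_la in the h_κ. At `const false` its value is e_la; the values at mixed tags
  -- are what `inner-eComb` consumes.
  eComb : List ℕ → HComb
  eComb la = proj₁ (spanned-transpose-gProd la)

  evalS-eComb : ∀ la s → evalS s (eComb la) ≈ gProd (not ∘ s) la
  evalS-eComb la = proj₂ (spanned-transpose-gProd la)

-- The Hall inner product

toSym-evalS : ∀ H → toSym H ≈ evalS (const false) H
toSym-evalS H ν = trans (sym (∑≡sumℚ H _))
  (∑-cong H (λ (c , κ) → cong (c *_) (sym (gProd-false κ ν))))

inner-∑ : ∀ H G → inner H G ≡ ∑ H (λ (c , κ) → c * G κ)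
inner-∑ H G = trans (sym (∑≡sumℚ H _)) (∑-cong H (λ (c , κ) → refl))

inner-cong : ∀ H {F G} → F ≈ G → inner H F ≡ inner H G
inner-cong H {F} {G} F≈G = trans (inner-∑ H F)
  (trans (∑-cong H (λ (c , κ) → cong (c *_) (F≈G κ))) (sym (inner-∑ H G)))

toSym-singleton : ∀ μ → toSym ((1ℚ , μ) ∷ []) ≈ hProd μ
toSym-singleton μ ν = trans (ℚₚ.+-identityʳ _) (ℚₚ.*-identityˡ _)

inner-singleton : ∀ μ G → inner ((1ℚ , μ) ∷ []) G ≡ G μ
inner-singleton μ G = trans (ℚₚ.+-identityʳ _) (ℚₚ.*-identityˡ _)

-- By `gProd-rows` the coefficient at κ of a row function with row sums ν is the coefficient at ν of
-- `gProd s κ`, so this pairing is an evaluation at the exponent vector ν.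
inner-rows : ∀ s H ν → inner H (rows s ν) ≡ evalS s H ν
inner-rows s H ν = trans (inner-∑ H (rows s ν))
  (∑-cong H (λ (c , κ) → cong (c *_) (sym (gProd-rows s κ ν))))

inner-hProd : ∀ H ν → inner H (hProd ν) ≡ toSym H ν
inner-hProd H ν = begin
  inner H (hProd ν)              ≡⟨ inner-cong H (λ ρ → sym (rows-false ν ρ)) ⟩
  inner H (rows (const false) ν) ≡⟨ inner-rows (const false) H ν ⟩
  evalS (const false) H ν        ≡⟨ sym (toSym-evalS H ν) ⟩
  toSym H ν                      ∎

-- The test function is h_ν: pairing with it extracts the coefficient at ν. Any presentation of `F`
-- may then be put on the left.
perp-coefficient : ∀ g F {P} → IsPerp g F P → ∀ H → toSym H ≈ F →
                   ∀ ν → P ν ≡ inner H (g ⊛ hProd ν)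
perp-coefficient g F {P} (HP , HP≈P , adjoint) H H≈F ν = begin
  P ν                                       ≡⟨ sym (HP≈P ν) ⟩
  toSym HP ν                                ≡⟨ sym (inner-hProd HP ν) ⟩
  inner HP (hProd ν)                        ≡⟨ inner-cong HP (λ ρ → sym (toSym-singleton ν ρ)) ⟩
  inner HP (toSym ((1ℚ , ν) ∷ []))          ≡⟨ adjoint H H≈F ((1ℚ , ν) ∷ []) ⟩
  inner H (g ⊛ toSym ((1ℚ , ν) ∷ []))       ≡⟨ inner-cong H (⊛-cong (≈-refl {g}) (toSym-singleton ν)) ⟩
  inner H (g ⊛ hProd ν)                     ∎

-- Separates the rows of κ from those of ν in κ ++ ν, so that the row function becomes e_κ h_ν, and
-- h_κ e_ν after transposition.
mark : ℕ → ℕ → Bool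
mark zero    _       = false
mark (suc n) zero    = true
mark (suc n) (suc i) = mark n i

rows-mark : ∀ κ ν → rows (mark (length κ)) (κ ++ ν) ≈ eProd κ ⊛ hProd ν
rows-mark []      ν ρ = trans (rows-false ν ρ) (sym (⊛-identityˡ (hProd ν) ρ))
rows-mark (n ∷ κ) ν ρ = trans (⊛-cong (≈-refl {eS n}) (rows-mark κ ν) ρ)
  (sym (⊛-assoc (eS n) (eProd κ) (hProd ν) ρ))

rows-not-mark : ∀ κ ν → rows (not ∘ mark (length κ)) (κ ++ ν) ≈ hProd κ ⊛ eProd ν
rows-not-mark []      ν ρ = trans (rows-true ν ρ) (sym (⊛-identityˡ (eProd ν) ρ))
rows-not-mark (n ∷ κ) ν ρ = trans (⊛-cong (≈-refl {hS n}) (rows-not-mark κ ν) ρ)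
  (sym (⊛-assoc (hS n) (hProd κ) (eProd ν) ρ))

-- ω is an isometry, in the only case needed.
inner-eComb : ∀ la κ ν → inner (eComb la) (eProd κ ⊛ hProd ν) ≡ (hProd κ ⊛ eProd ν) la
inner-eComb la κ ν = begin
  inner (eComb la) (eProd κ ⊛ hProd ν)
    ≡⟨ inner-cong (eComb la) (λ ρ → sym (rows-mark κ ν ρ)) ⟩
  inner (eComb la) (rows s (κ ++ ν))
    ≡⟨ inner-rows s (eComb la) (κ ++ ν) ⟩
  evalS s (eComb la) (κ ++ ν)
    ≡⟨ evalS-eComb la s (κ ++ ν) ⟩
  gProd (not ∘ s) la (κ ++ ν)
    ≡⟨ gProd-rows (not ∘ s) la (κ ++ ν) ⟩
  rows (not ∘ s) (κ ++ ν) la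
    ≡⟨ rows-not-mark κ ν la ⟩
  (hProd κ ⊛ eProd ν) la ∎
  where s = mark (length κ)

-- Augmented monomial functions

picks : List ℕ → List (ℕ × List ℕ)
picks []      = []
picks (a ∷ μ) = (a , μ) ∷ map (λ (b , ρ) → b , a ∷ ρ) (picks μ)

∑-picks-∷ : ∀ a μ (f : ℕ → List ℕ → ℚ) →
  ∑ (picks (a ∷ μ)) (λ (b , ρ) → f b ρ) ≡ f a μ + ∑ (picks μ) (λ (b , ρ) → f b (a ∷ ρ))
∑-picks-∷ a μ f = trans (∑-∷ _ _ _) (cong (f a μ +_) (∑-map _ (picks μ) _))

-- Parts are stored one less than their value: merging the parts a + 1 and b + 1 gives a + b + 2,
-- stored as a + suc b.
bumps : ℕ → List ℕ → List (List ℕ)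
bumps a []      = []
bumps a (b ∷ μ) = (a ℕ.+ suc b ∷ μ) ∷ map (b ∷_) (bumps a μ)

∑-bumps-∷ : ∀ a b μ (f : List ℕ → ℚ) →
  ∑ (bumps a (b ∷ μ)) f ≡ f (a ℕ.+ suc b ∷ μ) + ∑ (bumps a μ) (λ ρ → f (b ∷ ρ))
∑-bumps-∷ a b μ f = trans (∑-∷ _ _ f) (cong (f (a ℕ.+ suc b ∷ μ) +_) (∑-map _ (bumps a μ) f))

bumps-length : ∀ a μ → All (λ ρ → length ρ ≡ length μ) (bumps a μ)
bumps-length a []      = []
bumps-length a (b ∷ μ) = refl ∷ Allₚ.map⁺ (All.map (cong suc) (bumps-length a μ))

-- An ordered choice of two distinct positions can be reversed. `X` and `Y` collect the choices with
-- the head picked first or second, `Z` those that avoid it.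
∑-picks-picks : ∀ μ (f : ℕ → ℕ → List ℕ → ℚ) →
  ∑ (picks μ) (λ (a , ρ) → ∑ (picks ρ) (λ (b , τ) → f a b τ)) ≡
  ∑ (picks μ) (λ (a , ρ) → ∑ (picks ρ) (λ (b , τ) → f b a τ))
∑-picks-picks []      f = trans (∑-[] _) (sym (∑-[] _))
∑-picks-picks (c ∷ μ) f = begin
  _ ≡⟨ expand f ⟩
  X + (Y + Z f)
    ≡⟨ cong (λ z → X + (Y + z)) (∑-picks-picks μ (λ a b τ → f a b (c ∷ τ))) ⟩
  X + (Y + Z (λ a b → f b a))
    ≡⟨ sym (ℚₚ.+-assoc X Y _) ⟩
  (X + Y) + Z (λ a b → f b a)
    ≡⟨ cong (_+ Z (λ a b → f b a)) (ℚₚ.+-comm X Y) ⟩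
  (Y + X) + Z (λ a b → f b a)
    ≡⟨ ℚₚ.+-assoc Y X _ ⟩
  Y + (X + Z (λ a b → f b a))
    ≡⟨ sym (expand (λ a b → f b a)) ⟩
  _ ∎
  where
  X = ∑ (picks μ) (λ (b , τ) → f c b τ)
  Y = ∑ (picks μ) (λ (a , ρ) → f a c ρ)
  Z : (ℕ → ℕ → List ℕ → ℚ) → ℚ
  Z f = ∑ (picks μ) (λ (a , ρ) → ∑ (picks ρ) (λ (b , τ) → f a b (c ∷ τ)))
  expand : ∀ f → ∑ (picks (c ∷ μ)) (λ (a , ρ) → ∑ (picks ρ) (λ (b , τ) → f a b τ)) ≡
    ∑ (picks μ) (λ (b , τ) → f c b τ) + (∑ (picks μ) (λ (a , ρ) → f a c ρ) + Z f)
  expand f = trans (∑-picks-∷ c μ (λ a ρ → ∑ (picks ρ) (λ (b , τ) → f a b τ)))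
    (cong (∑ (picks μ) (λ (b , τ) → f c b τ) +_) (trans
      (∑-cong (picks μ) (λ (a , ρ) → ∑-picks-∷ c ρ (f a)))
      (∑-+ (picks μ) (λ (a , ρ) → f a c ρ) (λ (a , ρ) → ∑ (picks ρ) (λ (b , τ) → f a b (c ∷ τ))))))

-- A pick from a bumped list takes either the bumped entry itself or another one, and in the latter
-- case picking and bumping can be exchanged.
∑-bumps-picks : ∀ a μ (f : ℕ → List ℕ → ℚ) →
  ∑ (bumps a μ) (λ ρ → ∑ (picks ρ) (λ (b , τ) → f b τ)) ≡
  ∑ (picks μ) (λ (b , ρ) → f (a ℕ.+ suc b) ρ) +
  ∑ (picks μ) (λ (b , ρ) → ∑ (bumps a ρ) (f b))
∑-bumps-picks a []      f = trans (∑-[] _) (sym (cong₂ _+_ (∑-[] _) (∑-[] _)))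
∑-bumps-picks a (c ∷ μ) f = begin
  ∑ (bumps a (c ∷ μ)) (λ ρ → ∑ (picks ρ) (λ (b , τ) → f b τ))
    ≡⟨ ∑-bumps-∷ a c μ _ ⟩
  ∑ (picks (a ℕ.+ suc c ∷ μ)) (λ (b , τ) → f b τ) +
  ∑ (bumps a μ) (λ ρ → ∑ (picks (c ∷ ρ)) (λ (b , τ) → f b τ))
    ≡⟨ cong₂ _+_ (∑-picks-∷ (a ℕ.+ suc c) μ f)
         (trans (∑-cong (bumps a μ) (λ ρ → ∑-picks-∷ c ρ f))
           (trans (∑-+ (bumps a μ) (f c) _) (cong (S +_) (∑-bumps-picks a μ (λ b τ → f b (c ∷ τ)))))) ⟩
  (P + Q) + (S + (R + T))
    ≡⟨ shuffle P Q S R T ⟩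
  (P + R) + (S + (Q + T))
    ≡⟨ sym (cong₂ _+_ (∑-picks-∷ c μ (λ b ρ → f (a ℕ.+ suc b) ρ))
         (trans (∑-picks-∷ c μ (λ b ρ → ∑ (bumps a ρ) (f b)))
           (cong (S +_) (trans (∑-cong (picks μ) (λ (b , ρ) → ∑-bumps-∷ a c ρ (f b)))
             (∑-+ (picks μ) _ _))))) ⟩
  ∑ (picks (c ∷ μ)) (λ (b , ρ) → f (a ℕ.+ suc b) ρ) +
  ∑ (picks (c ∷ μ)) (λ (b , ρ) → ∑ (bumps a ρ) (f b)) ∎
  where
  P = f (a ℕ.+ suc c) μ
  Q = ∑ (picks μ) (λ (b , τ) → f b (a ℕ.+ suc c ∷ τ))
  R = ∑ (picks μ) (λ (b , ρ) → f (a ℕ.+ suc b) (c ∷ ρ))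
  S = ∑ (bumps a μ) (f c)
  T = ∑ (picks μ) (λ (b , ρ) → ∑ (bumps a ρ) (λ τ → f b (c ∷ τ)))
  shuffle : ∀ p q s r t → (p + q) + (s + (r + t)) ≡ (p + r) + (s + (q + t))
  shuffle = solve 5 (λ p q s r t → (p :+ q) :+ (s :+ (r :+ t)) := (p :+ r) :+ (s :+ (q :+ t))) refl
    where open +-*-Solver

null : List ℕ → Bool
null []      = true
null (_ ∷ _) = false

-- The list (a₁,…,a_r) stands for the parts a₁+1,…,a_r+1, so that no part vanishes; the coefficient
-- at ν counts the ways of placing the parts in distinct positions of ν so as to fill ν.
augmented : List ℕ → Sym
augmented μ []          = χ (null μ)
augmented μ (zero ∷ ν)  = augmented μ ν
augmented μ (suc x ∷ ν) = ∑ (picks μ) (λ (a , ρ) → χ (a ≡ᵇ x) * augmented ρ ν)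

augmented-[] : augmented [] ≈ oneS
augmented-[] []          = refl
augmented-[] (zero ∷ ν)  = augmented-[] ν
augmented-[] (suc x ∷ ν) = ∑-[] _

augmented-∷ : ∀ μ x ν → augmented μ (x ∷ ν) ≡
  χ (0 ≡ᵇ x) * augmented μ ν + ∑ (picks μ) (λ (a , ρ) → χ (suc a ≡ᵇ x) * augmented ρ ν)
augmented-∷ μ zero ν = sym (begin
  1ℚ * augmented μ ν + ∑ (picks μ) (λ (a , ρ) → 0ℚ * augmented ρ ν)
    ≡⟨ cong₂ _+_ (ℚₚ.*-identityˡ (augmented μ ν))
         (∑-zero (picks μ) (λ (a , ρ) → ℚₚ.*-zeroˡ (augmented ρ ν))) ⟩
  augmented μ ν + 0ℚ
    ≡⟨ ℚₚ.+-identityʳ (augmented μ ν) ⟩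
  augmented μ ν ∎)
augmented-∷ μ (suc x) ν = sym (trans
  (cong (_+ ∑ (picks μ) (λ (a , ρ) → χ (a ≡ᵇ x) * augmented ρ ν)) (ℚₚ.*-zeroˡ (augmented μ ν)))
  (ℚₚ.+-identityˡ _))

-- The sum of the power sums of all positive degrees: 1 on the exponent vectors with a single
-- nonzero entry, 0 elsewhere. `pS` cuts out one degree.
hook : List ℕ → ℚ
hook []          = 0ℚ
hook (zero ∷ α)  = hook α
hook (suc _ ∷ α) = oneS α

-- The power sum p_n for n ≥ 1, but pS 0 = 0.
pS : ℕ → Sym
pS n α = hook α * χ (sum α ≡ᵇ n)

-- A power sum has no mixed monomials: once x₁ occurs, no other variable does.
pS-∂ : ∀ a i → pS (suc a) ∂ suc i ≈ scale (χ (a ≡ᵇ i)) oneS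
pS-∂ a i ν = go (sum ν) a i
  where
  go : ∀ m a i → χ (m ≡ᵇ 0) * χ (i ℕ.+ m ≡ᵇ a) ≡ χ (a ≡ᵇ i) * χ (m ≡ᵇ 0)
  go zero a i = trans (ℚₚ.*-identityˡ _) (trans (cong χ (≡ᵇ-comm (i ℕ.+ 0) a))
    (trans (cong (λ j → χ (a ≡ᵇ j)) (ℕₚ.+-identityʳ i)) (sym (ℚₚ.*-identityʳ _))))
    where
    ≡ᵇ-comm : ∀ m n → (m ≡ᵇ n) ≡ (n ≡ᵇ m)
    ≡ᵇ-comm zero    zero    = refl
    ≡ᵇ-comm zero    (suc n) = refl
    ≡ᵇ-comm (suc m) zero    = refl
    ≡ᵇ-comm (suc m) (suc n) = ≡ᵇ-comm m n
  go (suc m) a i = trans (ℚₚ.*-zeroˡ (χ (i ℕ.+ suc m ≡ᵇ a))) (sym (ℚₚ.*-zeroʳ (χ (a ≡ᵇ i))))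

-- The factor x_i^{a+1} meets either a free position, where it becomes a new part, or an occupied
-- one, whose part it enlarges.
pS-⊛-augmented : ∀ a μ ν → (pS (suc a) ⊛ augmented μ) ν ≡
  augmented (a ∷ μ) ν + ∑ (bumps a μ) (λ ρ → augmented ρ ν)
pS-⊛-augmented a μ [] = trans (⊛-[] (pS (suc a)) (augmented μ))
  (trans (ℚₚ.*-zeroˡ (χ (null μ))) (sym (trans (ℚₚ.+-identityˡ _) (go μ))))
  where
  go : ∀ μ → ∑ (bumps a μ) (λ ρ → χ (null ρ)) ≡ 0ℚ
  go []      = ∑-[] _
  go (b ∷ μ) = trans (∑-bumps-∷ a b μ _) (trans (ℚₚ.+-identityˡ _) (∑-0 (bumps a μ)))
pS-⊛-augmented a μ (zero ∷ ν) = trans (⊛-∷ (pS (suc a)) (augmented μ) 0 ν)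
  (trans (∑-singleton (0 , 0) _) (pS-⊛-augmented a μ ν))
pS-⊛-augmented a μ (suc x ∷ ν) = begin
  (pS (suc a) ⊛ augmented μ) (suc x ∷ ν)
    ≡⟨ trans (⊛-∷ (pS (suc a)) (augmented μ) (suc x) ν) (∑-antidiag-suc x _) ⟩
  (pS (suc a) ⊛ augmented μ ∂ suc x) ν +
  ∑ (antidiag x) (λ (i , j) → (pS (suc a) ∂ suc i ⊛ augmented μ ∂ j) ν)
    ≡⟨ cong₂ _+_ shifted placed ⟩
  (X + Z) + (W + Y)
    ≡⟨ shuffle X Z W Y ⟩
  (W + X) + (Y + Z)
    ≡⟨ sym (cong₂ _+_ (∑-picks-∷ a μ (λ b ρ → χ (b ≡ᵇ x) * augmented ρ ν))
         (∑-bumps-picks a μ (λ b ρ → χ (b ≡ᵇ x) * augmented ρ ν))) ⟩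
  augmented (a ∷ μ) (suc x ∷ ν) + ∑ (bumps a μ) (λ ρ → augmented ρ (suc x ∷ ν)) ∎
  where
  -- Cases for the first position, whose exponent is x + 1: in `W` it holds the new part alone, in
  -- `Y` the new part merged with an old one; in `X` and `Z` it holds an old part alone, and the
  -- power goes to a later position that is free or occupied, respectively.
  W = χ (a ≡ᵇ x) * augmented μ ν
  X = ∑ (picks μ) (λ (b , ρ) → χ (b ≡ᵇ x) * augmented (a ∷ ρ) ν)
  Y = ∑ (picks μ) (λ (b , ρ) → χ (a ℕ.+ suc b ≡ᵇ x) * augmented ρ ν)
  Z = ∑ (picks μ) (λ (b , ρ) → ∑ (bumps a ρ) (λ τ → χ (b ≡ᵇ x) * augmented τ ν))
  shuffle : ∀ x z w y → (x + z) + (w + y) ≡ (w + x) + (y + z)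
  shuffle = solve 4 (λ x z w y → (x :+ z) :+ (w :+ y) := (w :+ x) :+ (y :+ z)) refl
    where open +-*-Solver
  shifted : (pS (suc a) ⊛ augmented μ ∂ suc x) ν ≡ X + Z
  shifted = begin
    (pS (suc a) ⊛ augmented μ ∂ suc x) ν
      ≡⟨ ⊛-∑ʳ (picks μ) (pS (suc a)) (λ (b , ρ) → scale (χ (b ≡ᵇ x)) (augmented ρ)) ν ⟩
    ∑ (picks μ) (λ (b , ρ) → (pS (suc a) ⊛ scale (χ (b ≡ᵇ x)) (augmented ρ)) ν)
      ≡⟨ ∑-cong (picks μ) (λ (b , ρ) → begin
           (pS (suc a) ⊛ scale (χ (b ≡ᵇ x)) (augmented ρ)) ν
             ≡⟨ ⊛-scaleʳ (χ (b ≡ᵇ x)) (pS (suc a)) (augmented ρ) ν ⟩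
           χ (b ≡ᵇ x) * (pS (suc a) ⊛ augmented ρ) ν
             ≡⟨ cong (χ (b ≡ᵇ x) *_) (pS-⊛-augmented a ρ ν) ⟩
           χ (b ≡ᵇ x) * (augmented (a ∷ ρ) ν + ∑ (bumps a ρ) (λ τ → augmented τ ν))
             ≡⟨ ℚₚ.*-distribˡ-+ (χ (b ≡ᵇ x)) _ _ ⟩
           χ (b ≡ᵇ x) * augmented (a ∷ ρ) ν + χ (b ≡ᵇ x) * ∑ (bumps a ρ) (λ τ → augmented τ ν)
             ≡⟨ cong (χ (b ≡ᵇ x) * augmented (a ∷ ρ) ν +_) (sym (∑-*ˡ (bumps a ρ) (χ (b ≡ᵇ x)) _)) ⟩
           χ (b ≡ᵇ x) * augmented (a ∷ ρ) ν + ∑ (bumps a ρ) (λ τ → χ (b ≡ᵇ x) * augmented τ ν) ∎) ⟩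
    ∑ (picks μ) (λ (b , ρ) →
      χ (b ≡ᵇ x) * augmented (a ∷ ρ) ν + ∑ (bumps a ρ) (λ τ → χ (b ≡ᵇ x) * augmented τ ν))
      ≡⟨ ∑-+ (picks μ) _ _ ⟩
    X + Z ∎
  placed : ∑ (antidiag x) (λ (i , j) → (pS (suc a) ∂ suc i ⊛ augmented μ ∂ j) ν) ≡ W + Y
  placed = begin
    ∑ (antidiag x) (λ (i , j) → (pS (suc a) ∂ suc i ⊛ augmented μ ∂ j) ν)
      ≡⟨ ∑-cong (antidiag x) (λ (i , j) → begin
           (pS (suc a) ∂ suc i ⊛ augmented μ ∂ j) ν
             ≡⟨ ⊛-cong (pS-∂ a i) (≈-refl {augmented μ ∂ j}) ν ⟩
           (scale (χ (a ≡ᵇ i)) oneS ⊛ augmented μ ∂ j) ν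
             ≡⟨ ⊛-scaleˡ (χ (a ≡ᵇ i)) oneS (augmented μ ∂ j) ν ⟩
           χ (a ≡ᵇ i) * (oneS ⊛ augmented μ ∂ j) ν
             ≡⟨ cong (χ (a ≡ᵇ i) *_)
                  (trans (⊛-identityˡ (augmented μ ∂ j) ν) (augmented-∷ μ j ν)) ⟩
           χ (a ≡ᵇ i) * (χ (0 ≡ᵇ j) * augmented μ ν +
             ∑ (picks μ) (λ (b , ρ) → χ (suc b ≡ᵇ j) * augmented ρ ν))
             ≡⟨ ℚₚ.*-distribˡ-+ (χ (a ≡ᵇ i)) _ _ ⟩
           _
             ≡⟨ cong₂ _+_ (sym (ℚₚ.*-assoc (χ (a ≡ᵇ i)) (χ (0 ≡ᵇ j)) (augmented μ ν)))
                  (trans (sym (∑-*ˡ (picks μ) (χ (a ≡ᵇ i)) _)) (∑-cong (picks μ) (λ (b , ρ) →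
                    sym (ℚₚ.*-assoc (χ (a ≡ᵇ i)) (χ (suc b ≡ᵇ j)) (augmented ρ ν))))) ⟩
           χ (a ≡ᵇ i) * χ (0 ≡ᵇ j) * augmented μ ν +
           ∑ (picks μ) (λ (b , ρ) → χ (a ≡ᵇ i) * χ (suc b ≡ᵇ j) * augmented ρ ν) ∎) ⟩
    ∑ (antidiag x) (λ (i , j) → χ (a ≡ᵇ i) * χ (0 ≡ᵇ j) * augmented μ ν +
      ∑ (picks μ) (λ (b , ρ) → χ (a ≡ᵇ i) * χ (suc b ≡ᵇ j) * augmented ρ ν))
      ≡⟨ trans (∑-+ (antidiag x) _ _) (cong₂ _+_ (collect 0 (augmented μ ν))
           (trans (∑-swap (antidiag x) (picks μ) _)
             (∑-cong (picks μ) (λ (b , ρ) → collect (suc b) (augmented ρ ν))))) ⟩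
    χ (a ℕ.+ 0 ≡ᵇ x) * augmented μ ν + Y
      ≡⟨ cong (λ m → χ (m ≡ᵇ x) * augmented μ ν + Y) (ℕₚ.+-identityʳ a) ⟩
    W + Y ∎
    where
    collect : ∀ b c → ∑ (antidiag x) (λ (i , j) → χ (a ≡ᵇ i) * χ (b ≡ᵇ j) * c) ≡
                      χ (a ℕ.+ b ≡ᵇ x) * c
    collect b c = trans (∑-*ʳ (antidiag x) c _) (cong (_* c) (∑-antidiag-χ x a b))

-- Newton's identities and the span of the h_κ

fromℕ : ℕ → ℚ
fromℕ zero    = 0ℚ
fromℕ (suc n) = 1ℚ + fromℕ n

fromℕ-+ : ∀ m n → fromℕ (m ℕ.+ n) ≡ fromℕ m + fromℕ n
fromℕ-+ zero    n = sym (ℚₚ.+-identityˡ (fromℕ n))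
fromℕ-+ (suc m) n = trans (cong (1ℚ +_) (fromℕ-+ m n)) (sym (ℚₚ.+-assoc 1ℚ (fromℕ m) (fromℕ n)))

∑-antidiag-1 : ∀ n → ∑ (antidiag n) (λ _ → 1ℚ) ≡ fromℕ (suc n)
∑-antidiag-1 zero    = trans (∑-singleton (0 , 0) _) refl
∑-antidiag-1 (suc n) = trans (∑-antidiag-suc n _) (cong (1ℚ +_) (∑-antidiag-1 n))

∑-splits-oneS : ∀ ν → ∑ (splits ν) (λ (α , β) → oneS α) ≡ 1ℚ
∑-splits-oneS ν = begin
  ∑ (splits ν) (λ (α , β) → oneS α)      ≡⟨ ∑-cong (splits ν) (λ (α , β) → sym (ℚₚ.*-identityʳ (oneS α))) ⟩
  ∑ (splits ν) (λ (α , β) → oneS α * 1ℚ) ≡⟨ sym (⊛-splits oneS (λ _ → 1ℚ) ν) ⟩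
  (oneS ⊛ (λ _ → 1ℚ)) ν                  ≡⟨ ⊛-identityˡ (λ _ → 1ℚ) ν ⟩
  1ℚ                                     ∎

-- A vector below ν with a single nonzero entry is a position together with a value from 1 to the
-- entry of ν there, which makes |ν| choices.
∑-splits-hook : ∀ ν → ∑ (splits ν) (λ (α , β) → hook α) ≡ fromℕ (sum ν)
∑-splits-hook []           = ∑-singleton ([] , []) _
∑-splits-hook (zero ∷ ν)   = trans (∑-splits-∷ 0 ν _) (trans (∑-singleton (0 , 0) _) (∑-splits-hook ν))
∑-splits-hook (suc n ∷ ν)  = begin
  ∑ (splits (suc n ∷ ν)) (λ (α , β) → hook α)
    ≡⟨ trans (∑-splits-∷ (suc n) ν _) (∑-antidiag-suc n _) ⟩
  ∑ (splits ν) (λ (α , β) → hook α) + ∑ (antidiag n) (λ (a , b) → ∑ (splits ν) (λ (α , β) → oneS α))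
    ≡⟨ cong₂ _+_ (∑-splits-hook ν)
         (trans (∑-cong (antidiag n) (λ _ → ∑-splits-oneS ν)) (∑-antidiag-1 n)) ⟩
  fromℕ (sum ν) + fromℕ (suc n)
    ≡⟨ ℚₚ.+-comm (fromℕ (sum ν)) (fromℕ (suc n)) ⟩
  fromℕ (suc n) + fromℕ (sum ν)
    ≡⟨ sym (fromℕ-+ (suc n) (sum ν)) ⟩
  fromℕ (sum (suc n ∷ ν)) ∎

-- Every monomial has coefficient 1 in the complete function of its degree, so x^ν arises on the
-- left once for each way of splitting off a positive power of one variable: |ν| times.
newton : ∀ n ν →
  ∑ (antidiag n) (λ (i , j) → (pS i ⊛ gS (const false) j) ν) ≡ fromℕ n * gS (const false) n ν
newton n ν = begin
  ∑ (antidiag n) (λ (i , j) → (pS i ⊛ gS (const false) j) ν)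
    ≡⟨ ∑-cong (antidiag n) (λ (i , j) → sym (ℚₚ.*-identityˡ ((pS i ⊛ gS (const false) j) ν))) ⟩
  ∑ (antidiag n) (λ (i , j) → 1ℚ * (pS i ⊛ gS (const false) j) ν)
    ≡⟨ ∑-antidiag-graded n ν (λ _ → 1ℚ) hook (weights (const false)) (λ _ _ → refl) ⟩
  ∑ (splits ν) (λ (α , β) → 1ℚ * (hook α * weights (const false) β)) * χ (sum ν ≡ᵇ n)
    ≡⟨ cong (_* χ (sum ν ≡ᵇ n)) (trans (∑-cong (splits ν) (λ (α , β) →
         trans (ℚₚ.*-identityˡ _) (trans (cong (hook α *_) (weights-false β)) (ℚₚ.*-identityʳ (hook α)))))
         (∑-splits-hook ν)) ⟩
  fromℕ (sum ν) * χ (sum ν ≡ᵇ n)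
    ≡⟨ f-χ fromℕ (sum ν) n ⟩
  fromℕ n * χ (sum ν ≡ᵇ n)
    ≡⟨ cong (fromℕ n *_) (sym (gS-false n ν)) ⟩
  fromℕ n * gS (const false) n ν ∎

pS-0 : pS 0 ≈ zeroS
pS-0 []          = refl
pS-0 (zero ∷ ν)  = pS-0 ν
pS-0 (suc x ∷ ν) = ℚₚ.*-zeroʳ (oneS ν)

+≡⇒≡- : ∀ x {y z} → x + y ≡ z → y ≡ z + - 1ℚ * x
+≡⇒≡- x {y} {z} p = trans (solve 2 (λ x y → y := (x :+ y) :+ con (- 1ℚ) :* x) refl x y)
  (cong (_+ - 1ℚ * x) p)
  where open +-*-Solver

-- In Newton's identity of degree n + 1 the top power sum is multiplied by h_0 = 1, so it can be
-- solved for without division.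
pS-suc : ∀ n ν → pS (suc n) ν ≡ fromℕ (suc n) * gS (const false) (suc n) ν +
  - 1ℚ * ∑ (antidiag n) (λ (i , j) → (pS i ⊛ gS (const false) (suc j)) ν)
pS-suc n ν = +≡⇒≡- (∑ (antidiag n) (λ (i , j) → (pS i ⊛ gS (const false) (suc j)) ν)) (begin
  ∑ (antidiag n) (λ (i , j) → (pS i ⊛ gS (const false) (suc j)) ν) + pS (suc n) ν
    ≡⟨ cong (∑ (antidiag n) (λ (i , j) → (pS i ⊛ gS (const false) (suc j)) ν) +_) (sym (trans
         (⊛-cong (≈-refl {pS (suc n)}) (gS-0 (const false)) ν)
         (trans (⊛-comm (pS (suc n)) oneS ν) (⊛-identityˡ (pS (suc n)) ν)))) ⟩
  ∑ (antidiag n) (λ (i , j) → (pS i ⊛ gS (const false) (suc j)) ν) +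
  (pS (suc n) ⊛ gS (const false) 0) ν
    ≡⟨ sym (∑-antidiag-sucʳ n (λ (i , j) → (pS i ⊛ gS (const false) j) ν)) ⟩
  ∑ (antidiag (suc n)) (λ (i , j) → (pS i ⊛ gS (const false) j) ν)
    ≡⟨ newton (suc n) ν ⟩
  fromℕ (suc n) * gS (const false) (suc n) ν ∎)

module ToSymSpan = Span {⊤} (λ _ _ → false)

module _ where
  open ToSymSpan

  spanned-pS : ∀ n → Spanned (λ _ → pS n)
  spanned-pS n = go n n ℕₚ.≤-refl
    where
    go : ∀ N n → n ≤ N → Spanned (λ _ → pS n)
    go N zero n≤N = [] , λ _ ν → trans (∑-[] _) (sym (pS-0 ν))
    go (suc N) (suc n) (s≤s n≤N) = spanned-cong (λ _ ν → sym (pS-suc n ν))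
      (spanned-⊕ (spanned-scale (fromℕ (suc n)) (spanned-gS (suc n)))
        (spanned-scale (- 1ℚ) (spanned-∑ (antidiag-sum n) (λ (i , j) i+j≡n → spanned-⊛
          (go N i (ℕₚ.≤-trans (ℕₚ.≤-trans (ℕₚ.m≤m+n i j) (ℕₚ.≤-reflexive i+j≡n)) n≤N))
          (spanned-gS (suc j))))))

  -- Multiplying by a power sum adds it as a new part or to an old one, and only the former changes
  -- the length: hence the recursion on the length.
  spanned-augmented : ∀ n μ → length μ ≡ n → Spanned (λ _ → augmented μ)
  spanned-augmented n [] _ = spanned-cong (λ _ ν → sym (augmented-[] ν)) (spanned-gProd [])
  spanned-augmented (suc n) (a ∷ μ) l = spanned-cong
    (λ _ ν → sym (+≡⇒≡- (∑ (bumps a μ) (λ ρ → augmented ρ ν))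
      (trans (ℚₚ.+-comm _ (augmented (a ∷ μ) ν)) (sym (pS-⊛-augmented a μ ν)))))
    (spanned-⊕ (spanned-⊛ (spanned-pS (suc a)) (spanned-augmented n μ (ℕₚ.suc-injective l)))
      (spanned-scale (- 1ℚ) (spanned-∑ (bumps-length a μ) (λ ρ |ρ|≡|μ| →
        spanned-augmented n ρ (trans |ρ|≡|μ| (ℕₚ.suc-injective l))))))

-- Monomial functions as multiples of augmented ones

augmented-swap : ∀ μ x y ν → augmented μ (x ∷ y ∷ ν) ≡ augmented μ (y ∷ x ∷ ν)
augmented-swap μ zero    zero    ν = refl
augmented-swap μ zero    (suc y) ν = refl
augmented-swap μ (suc x) zero    ν = refl
augmented-swap μ (suc x) (suc y) ν = begin
  augmented μ (suc x ∷ suc y ∷ ν)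
    ≡⟨ ∑-cong (picks μ) (λ (a , ρ) → sym (∑-*ˡ (picks ρ) (χ (a ≡ᵇ x)) _)) ⟩
  ∑ (picks μ) (λ (a , ρ) → ∑ (picks ρ) (λ (b , τ) → χ (a ≡ᵇ x) * (χ (b ≡ᵇ y) * augmented τ ν)))
    ≡⟨ ∑-picks-picks μ (λ a b τ → χ (a ≡ᵇ x) * (χ (b ≡ᵇ y) * augmented τ ν)) ⟩
  ∑ (picks μ) (λ (a , ρ) → ∑ (picks ρ) (λ (b , τ) → χ (b ≡ᵇ x) * (χ (a ≡ᵇ y) * augmented τ ν)))
    ≡⟨ ∑-cong (picks μ) (λ (a , ρ) → ∑-cong (picks ρ) (λ (b , τ) →
         *ₚ.x∙yz≈y∙xz (χ (b ≡ᵇ x)) (χ (a ≡ᵇ y)) (augmented τ ν))) ⟩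
  ∑ (picks μ) (λ (a , ρ) → ∑ (picks ρ) (λ (b , τ) → χ (a ≡ᵇ y) * (χ (b ≡ᵇ x) * augmented τ ν)))
    ≡⟨ ∑-cong (picks μ) (λ (a , ρ) → ∑-*ˡ (picks ρ) (χ (a ≡ᵇ y)) _) ⟩
  augmented μ (suc y ∷ suc x ∷ ν) ∎

augmented-prep : ∀ x {ν ν′} → (∀ μ → augmented μ ν ≡ augmented μ ν′) →
                 ∀ μ → augmented μ (x ∷ ν) ≡ augmented μ (x ∷ ν′)
augmented-prep zero    ν≈ν′ μ = ν≈ν′ μ
augmented-prep (suc x) ν≈ν′ μ = ∑-cong (picks μ) (λ (a , ρ) → cong (χ (a ≡ᵇ x) *_) (ν≈ν′ ρ))

augmented-↭ : ∀ {ν ν′} → ν ↭ ν′ → ∀ μ → augmented μ ν ≡ augmented μ ν′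
augmented-↭ Perm.refl          μ = refl
augmented-↭ (prep x p)         μ = augmented-prep x (augmented-↭ p) μ
augmented-↭ (swap {xs = ν} x y p) μ = trans (augmented-swap μ x y ν)
  (augmented-prep y (augmented-prep x (augmented-↭ p)) μ)
augmented-↭ (Perm.trans p q)   μ = trans (augmented-↭ p μ) (augmented-↭ q μ)

augmented-nonzero : ∀ ν μ → augmented μ (filterB nonzero ν) ≡ augmented μ ν
augmented-nonzero []          μ = refl
augmented-nonzero (zero ∷ ν)  μ = augmented-nonzero ν μ
augmented-nonzero (suc x ∷ ν) μ = augmented-prep (suc x) {filterB nonzero ν} {ν} (augmented-nonzero ν) μ

-- Translates a list of parts into the encoding of `augmented`, in which a stands for the part a +
-- 1.
preds : List ℕ → List ℕ
preds []          = []
preds (zero ∷ μ)  = preds μ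
preds (suc x ∷ μ) = x ∷ preds μ

suc-preds : ∀ μ → map suc (preds μ) ≡ filterB nonzero μ
suc-preds []          = refl
suc-preds (zero ∷ μ)  = suc-preds μ
suc-preds (suc x ∷ μ) = cong (suc x ∷_) (suc-preds μ)

picks-↭ : ∀ μ → All (λ (a , ρ) → μ ↭ a ∷ ρ) (picks μ)
picks-↭ []      = []
picks-↭ (a ∷ μ) = Perm.refl ∷ Allₚ.map⁺ (All.map
  (λ {(b , ρ)} μ↭b∷ρ → Perm.trans (prep a μ↭b∷ρ) (swap a b Perm.refl)) (picks-↭ μ))

∑-zero-or : ∀ {Q : Set} {xs} {f : A → ℚ} → All (λ x → f x ≡ 0ℚ ⊎ Q) xs → ∑ xs f ≡ 0ℚ ⊎ Q
∑-zero-or []            = inj₁ (∑-[] _)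
∑-zero-or (inj₂ q ∷ _)  = inj₂ q
∑-zero-or (inj₁ p ∷ ps) with ∑-zero-or ps
... | inj₁ p′ = inj₁ (trans (∑-∷ _ _ _) (trans (cong₂ _+_ p p′) (ℚₚ.+-identityˡ 0ℚ)))
... | inj₂ q  = inj₂ q

-- A nonzero coefficient comes from an actual placement of the parts, which exhibits them as a
-- rearrangement of the nonzero entries of ν.
augmented-support : ∀ ν μ → augmented μ ν ≡ 0ℚ ⊎ filterB nonzero ν ↭ map suc μ
augmented-support []          []      = inj₂ Perm.refl
augmented-support []          (a ∷ μ) = inj₁ refl
augmented-support (zero ∷ ν)  μ       = augmented-support ν μ
augmented-support (suc x ∷ ν) μ       = ∑-zero-or (All.map (λ {(a , ρ)} → term a ρ) (picks-↭ μ))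
  where
  term : ∀ a ρ → μ ↭ a ∷ ρ →
    χ (a ≡ᵇ x) * augmented ρ ν ≡ 0ℚ ⊎ suc x ∷ filterB nonzero ν ↭ map suc μ
  term a ρ μ↭a∷ρ with a ≡ᵇ x in eq
  ... | false = inj₁ (ℚₚ.*-zeroˡ (augmented ρ ν))
  ... | true  with augmented-support ν ρ
  ...   | inj₁ p = inj₁ (trans (ℚₚ.*-identityˡ _) p)
  ...   | inj₂ q with refl ← ℕₚ.≡ᵇ⇒≡ a x (subst Bool.T (sym eq) tt) =
    inj₂ (Perm.trans (prep (suc x) q) (Perm.↭-sym (Permₚ.map⁺ suc μ↭a∷ρ)))

∑-nonneg : ∀ (xs : List A) {f : A → ℚ} → (∀ x → 0ℚ ℚ.≤ f x) → 0ℚ ℚ.≤ ∑ xs f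
∑-nonneg []       0≤f = ℚₚ.≤-reflexive (sym (∑-[] _))
∑-nonneg (x ∷ xs) 0≤f = subst (0ℚ ℚ.≤_) (sym (∑-∷ x xs _))
  (ℚₚ.+-mono-≤ (0≤f x) (∑-nonneg xs 0≤f))

χ*-nonneg : ∀ b {x} → 0ℚ ℚ.≤ x → 0ℚ ℚ.≤ χ b * x
χ*-nonneg true  {x} 0≤x = subst (0ℚ ℚ.≤_) (sym (ℚₚ.*-identityˡ x)) 0≤x
χ*-nonneg false {x} 0≤x = ℚₚ.≤-reflexive (sym (ℚₚ.*-zeroˡ x))

augmented-nonneg : ∀ ν μ → 0ℚ ℚ.≤ augmented μ ν
augmented-nonneg []          []      = ℚₚ.nonNegative⁻¹ 1ℚ
augmented-nonneg []          (a ∷ μ) = ℚₚ.≤-refl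
augmented-nonneg (zero ∷ ν)  μ       = augmented-nonneg ν μ
augmented-nonneg (suc x ∷ ν) μ       =
  ∑-nonneg (picks μ) (λ (a , ρ) → χ*-nonneg (a ≡ᵇ x) (augmented-nonneg ν ρ))

≡ᵇ-refl : ∀ m → (m ≡ᵇ m) ≡ true
≡ᵇ-refl zero    = refl
≡ᵇ-refl (suc m) = ≡ᵇ-refl m

-- Putting every part in its own position is one admissible placement, and the others contribute
-- nonnegatively. This is what allows the division in `monomialComb`.
augmented-preds : ∀ ν → 1ℚ ℚ.≤ augmented (preds ν) ν
augmented-preds []          = ℚₚ.≤-refl
augmented-preds (zero ∷ ν)  = augmented-preds ν
augmented-preds (suc x ∷ ν) = subst (1ℚ ℚ.≤_)
  (sym (∑-picks-∷ x (preds ν) (λ a ρ → χ (a ≡ᵇ x) * augmented ρ ν)))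
  (ℚₚ.+-mono-≤ {1ℚ} {_} {0ℚ}
    (subst (1ℚ ℚ.≤_) (sym (trans (cong (λ b → χ b * augmented (preds ν) ν) (≡ᵇ-refl x))
      (ℚₚ.*-identityˡ _))) (augmented-preds ν))
    (∑-nonneg (picks (preds ν)) (λ (a , ρ) → χ*-nonneg (a ≡ᵇ x) (augmented-nonneg ν (x ∷ ρ)))))

open SortingAlgorithm (InsertionSort.insertionSort ℕₚ.≤-decTotalOrder) using (sort; sort-↭; sort-↗)

sort-injective-↭ : ∀ xs ys → sort xs ≡ sort ys → xs ↭ ys
sort-injective-↭ xs ys eq = Perm.trans (Perm.↭-sym (sort-↭ xs))
  (Perm.trans (Perm.↭-reflexive eq) (sort-↭ ys))

sort-cong-↭ : ∀ {xs ys} → xs ↭ ys → sort xs ≡ sort ys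
sort-cong-↭ {xs} {ys} p = Pointwise-≡⇒≡ (↗↭↗⇒≋ ℕₚ.≤-totalOrder (sort-↗ xs) (sort-↗ ys)
  (Perm.↭⇒↭ₛ (Perm.trans (sort-↭ xs) (Perm.trans p (Perm.↭-sym (sort-↭ ys))))))

mS-support : ∀ la ν → (mS la ν ≡ 1ℚ × filterB nonzero ν ↭ filterB nonzero la) ⊎
                      (mS la ν ≡ 0ℚ × (filterB nonzero ν ↭ filterB nonzero la → ⊥))
mS-support la ν with Listₚ.≡-dec ℕₚ._≟_ (sort (filterB nonzero ν)) (sort (filterB nonzero la))
... | yes eq = inj₁ (refl , sort-injective-↭ (filterB nonzero ν) (filterB nonzero la) eq)
... | no neq = inj₂ (refl , λ p → neq (sort-cong-↭ p))

-- Both series are supported on the rearrangements of `la` up to zeros, and by symmetry the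
-- augmented one is constant there. The constant is the product of the factorials of the
-- multiplicities of the nonzero parts.
mS-augmented : ∀ la ν →
  augmented (preds la) ν ≡ augmented (preds la) la * mS la ν
mS-augmented la ν with mS-support la ν
... | inj₁ (eq , p) = begin
  augmented κ ν                     ≡⟨ sym (augmented-nonzero ν κ) ⟩
  augmented κ (filterB nonzero ν)   ≡⟨ augmented-↭ p κ ⟩
  augmented κ (filterB nonzero la)  ≡⟨ augmented-nonzero la κ ⟩
  augmented κ la                    ≡⟨ sym (ℚₚ.*-identityʳ _) ⟩
  augmented κ la * 1ℚ               ≡⟨ cong (augmented κ la *_) (sym eq) ⟩
  augmented κ la * mS la ν          ∎
  where κ = preds la
... | inj₂ (eq , ¬p) with augmented-support ν (preds la)
...   | inj₁ q = trans q (sym (trans (cong (augmented (preds la) la *_) eq) (ℚₚ.*-zeroʳ (augmented (preds la) la))))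
...   | inj₂ p = contradiction (subst (filterB nonzero ν ↭_) (suc-preds la) p) ¬p

monomialComb : ∀ la → Σ HComb λ H → toSym H ≈ mS la
monomialComb la = proj₁ spanned , λ ν → begin
  toSym (proj₁ spanned) ν
    ≡⟨ toSym-evalS (proj₁ spanned) ν ⟩
  evalS (const false) (proj₁ spanned) ν
    ≡⟨ proj₂ spanned tt ν ⟩
  (ℚ.1/ c) * augmented (preds la) ν
    ≡⟨ cong ((ℚ.1/ c) *_) (mS-augmented la ν) ⟩
  (ℚ.1/ c) * (c * mS la ν)
    ≡⟨ sym (ℚₚ.*-assoc (ℚ.1/ c) c (mS la ν)) ⟩
  (ℚ.1/ c) * c * mS la ν
    ≡⟨ cong (_* mS la ν) (ℚₚ.*-inverseˡ c) ⟩
  1ℚ * mS la ν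
    ≡⟨ ℚₚ.*-identityˡ (mS la ν) ⟩
  mS la ν ∎
  where
  c = augmented (preds la) la
  instance
    c≢0 : ℚ.NonZero c
    c≢0 = ℚₚ.pos⇒nonZero c {{ℚ.positive (ℚₚ.<-≤-trans (ℚₚ.positive⁻¹ 1ℚ) (augmented-preds la))}}
  spanned : ToSymSpan.Spanned (λ _ → scale (ℚ.1/ c) (augmented (preds la)))
  spanned = ToSymSpan.spanned-scale (ℚ.1/ c) (spanned-augmented (length (preds la)) (preds la) refl)

-- Selecting a term of a sum over partitions

filterB-nonzero-↭ : ∀ {α β} → α ↭ β → filterB nonzero α ↭ filterB nonzero β
filterB-nonzero-↭ Perm.refl                = Perm.refl
filterB-nonzero-↭ (prep zero p)            = filterB-nonzero-↭ p
filterB-nonzero-↭ (prep (suc x) p)         = prep (suc x) (filterB-nonzero-↭ p)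
filterB-nonzero-↭ (swap zero zero p)       = filterB-nonzero-↭ p
filterB-nonzero-↭ (swap zero (suc y) p)    = prep (suc y) (filterB-nonzero-↭ p)
filterB-nonzero-↭ (swap (suc x) zero p)    = prep (suc x) (filterB-nonzero-↭ p)
filterB-nonzero-↭ (swap (suc x) (suc y) p) = swap (suc x) (suc y) (filterB-nonzero-↭ p)
filterB-nonzero-↭ (Perm.trans p q)         = Perm.trans (filterB-nonzero-↭ p) (filterB-nonzero-↭ q)

zeros : List ℕ → ℕ
zeros []          = 0
zeros (zero ∷ α)  = suc (zeros α)
zeros (suc _ ∷ α) = zeros α

nonzero++zeros : ∀ α → α ↭ filterB nonzero α ++ replicate (zeros α) 0
nonzero++zeros []          = Perm.refl
nonzero++zeros (zero ∷ α)  = Perm.trans (prep 0 (nonzero++zeros α))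
  (Perm.↭-sym (Permₚ.shift 0 (filterB nonzero α) (replicate (zeros α) 0)))
nonzero++zeros (suc x ∷ α) = prep (suc x) (nonzero++zeros α)

nonzero-zeros-length : ∀ α → length α ≡ length (filterB nonzero α) ℕ.+ zeros α
nonzero-zeros-length α = trans (Permₚ.↭-length (nonzero++zeros α))
  (trans (Listₚ.length-++ (filterB nonzero α))
    (cong (length (filterB nonzero α) ℕ.+_) (Listₚ.length-replicate (zeros α))))

-- With equal lengths and equally many nonzero entries, the numbers of zeros agree too. This links
-- `mS`, which ignores zeros, to the zero-padded lists of `partsUpTo`.
nonzero-↭⇒↭ : ∀ α β → length α ≡ length β → filterB nonzero α ↭ filterB nonzero β → α ↭ β
nonzero-↭⇒↭ α β |α|≡|β| p = Perm.trans (nonzero++zeros α)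
  (Perm.trans (Permₚ.++⁺ p (Perm.↭-reflexive (cong (λ z → replicate z 0) same-zeros)))
    (Perm.↭-sym (nonzero++zeros β)))
  where
  same-zeros : zeros α ≡ zeros β
  same-zeros = ℕₚ.+-cancelˡ-≡ (length (filterB nonzero α)) (zeros α) (zeros β)
    (trans (sym (nonzero-zeros-length α)) (trans |α|≡|β| (trans (nonzero-zeros-length β)
      (cong (ℕ._+ zeros β) (sym (Permₚ.↭-length p))))))

≥-decTotalOrder : DecTotalOrder _ _ _
≥-decTotalOrder = Flip.decTotalOrder ℕₚ.≤-decTotalOrder

module Decreasing = SortingAlgorithm (InsertionSort.insertionSort ≥-decTotalOrder)

∧-true : ∀ p q → p ∧ q ≡ true → p ≡ true × q ≡ true
∧-true true true _ = refl , refl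

≤ᵇ-true⇒≤ : ∀ m n → (m ≤ᵇ n) ≡ true → m ≤ n
≤ᵇ-true⇒≤ m n eq = ℕₚ.≤ᵇ⇒≤ m n (subst Bool.T (sym eq) tt)

≤⇒≤ᵇ-true : ∀ {m n} → m ≤ n → (m ≤ᵇ n) ≡ true
≤⇒≤ᵇ-true {m} {n} m≤n with m ≤ᵇ n | ℕₚ.≤⇒≤ᵇ m≤n
... | true | _ = refl

Linked⇒decreasing : ∀ {μ} → Linked (λ a b → b ≤ a) μ → decreasing μ ≡ true
Linked⇒decreasing []        = refl
Linked⇒decreasing [-]       = refl
Linked⇒decreasing (y≤x ∷ l) = cong₂ _∧_ (≤⇒≤ᵇ-true y≤x) (Linked⇒decreasing l)

decreasing⇒Linked : ∀ μ → decreasing μ ≡ true → Linked (λ a b → b ≤ a) μ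
decreasing⇒Linked []          _ = []
decreasing⇒Linked (x ∷ [])    _ = [-]
decreasing⇒Linked (x ∷ y ∷ μ) e =
  ≤ᵇ-true⇒≤ y x (proj₁ both) ∷ decreasing⇒Linked (y ∷ μ) (proj₂ both)
  where both = ∧-true (y ≤ᵇ x) (decreasing (y ∷ μ)) e

-- Equality of lists as a product over the entries, so that its sum over a box factors.
δ : List ℕ → List ℕ → ℚ
δ []      []      = 1ℚ
δ []      (_ ∷ _) = 0ℚ
δ (_ ∷ _) []      = 0ℚ
δ (a ∷ α) (b ∷ β) = χ (a ≡ᵇ b) * δ α β

δ-refl : ∀ α → δ α α ≡ 1ℚ
δ-refl []      = refl
δ-refl (a ∷ α) = trans (cong₂ _*_ (cong χ (≡ᵇ-refl a)) (δ-refl α)) refl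

δ-≢ : ∀ α β → (α ≡ β → ⊥) → δ α β ≡ 0ℚ
δ-≢ []      []      α≢β = contradiction refl α≢β
δ-≢ []      (_ ∷ _) α≢β = refl
δ-≢ (_ ∷ _) []      α≢β = refl
δ-≢ (a ∷ α) (b ∷ β) α≢β with a ≡ᵇ b in eq
... | false = ℚₚ.*-zeroˡ (δ α β)
... | true  = trans (ℚₚ.*-identityˡ _)
  (δ-≢ α β (λ α≡β → α≢β (cong₂ _∷_ (ℕₚ.≡ᵇ⇒≡ a b (subst Bool.T (sym eq) tt)) α≡β)))

∑-antidiag-select : ∀ {d n} → d ≤ n → ∑ (antidiag n) (λ (a , _) → χ (d ≡ᵇ a)) ≡ 1ℚ
∑-antidiag-select {zero}  {zero}  z≤n = ∑-singleton (0 , 0) _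
∑-antidiag-select {zero}  {suc n} z≤n = trans (∑-antidiag-suc n _)
  (trans (cong (1ℚ +_) (∑-0 (antidiag n))) (ℚₚ.+-identityʳ 1ℚ))
∑-antidiag-select {suc d} {suc n} (s≤s d≤n) = trans (∑-antidiag-suc n _)
  (trans (cong (0ℚ +_) (∑-antidiag-select d≤n)) (ℚₚ.+-identityˡ 1ℚ))

∑-below-δ : ∀ {N d} → All (_≤ N) d → ∑ (below (replicate (length d) N)) (δ d) ≡ 1ℚ
∑-below-δ []                      = ∑-singleton [] _
∑-below-δ {N} {a ∷ d} (a≤N ∷ d≤N) = begin
  ∑ (below (N ∷ replicate (length d) N)) (δ (a ∷ d))
    ≡⟨ ∑-concatMap _ (upTo (suc N)) _ ⟩
  ∑ (upTo (suc N)) (λ b → ∑ (map (b ∷_) (below (replicate (length d) N))) (δ (a ∷ d)))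
    ≡⟨ ∑-cong (upTo (suc N)) (λ b → ∑-map (b ∷_) (below (replicate (length d) N)) _) ⟩
  ∑ (upTo (suc N)) (λ b → ∑ (below (replicate (length d) N)) (λ β → χ (a ≡ᵇ b) * δ d β))
    ≡⟨ ∑-product (upTo (suc N)) (below (replicate (length d) N)) (λ b → χ (a ≡ᵇ b)) (δ d) ⟩
  ∑ (upTo (suc N)) (λ b → χ (a ≡ᵇ b)) * ∑ (below (replicate (length d) N)) (δ d)
    ≡⟨ cong₂ _*_ (trans (∑-upTo N (λ b _ → χ (a ≡ᵇ b))) (∑-antidiag-select a≤N)) (∑-below-δ d≤N) ⟩
  1ℚ ∎

below-length : ∀ ν → All (λ α → length α ≡ length ν) (below ν)
below-length []      = refl ∷ []
below-length (n ∷ ν) = Allₚ.concat⁺ (Allₚ.map⁺ (All.universal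
  (λ a → Allₚ.map⁺ (All.map (cong suc) (below-length ν))) (upTo (suc n))))

∑-filterB : ∀ (q : A → Bool) xs (f : A → ℚ) → ∑ (filterB q xs) f ≡ ∑ xs (λ x → χ (q x) * f x)
∑-filterB q []       f = trans (∑-[] f) (sym (∑-[] _))
∑-filterB q (x ∷ xs) f = sym (trans (∑-∷ x xs _) (trans (cong (χ (q x) * f x +_) (sym (∑-filterB q xs f))) (go (q x))))
  where
  go : ∀ b → χ b * f x + ∑ (filterB q xs) f ≡ ∑ (if b then x ∷ filterB q xs else filterB q xs) f
  go true  = trans (cong (_+ ∑ (filterB q xs) f) (ℚₚ.*-identityˡ (f x))) (sym (∑-∷ x (filterB q xs) f))
  go false = trans (cong (_+ ∑ (filterB q xs) f) (ℚₚ.*-zeroˡ (f x))) (ℚₚ.+-identityˡ _)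

all≤sum : ∀ α → All (_≤ sum α) α
all≤sum []      = []
all≤sum (a ∷ α) = ℕₚ.m≤m+n a (sum α) ∷
  All.map (λ x≤ → ℕₚ.≤-trans x≤ (ℕₚ.m≤n+m (sum α) a)) (all≤sum α)

-- Among the padded partitions of this length only the decreasing rearrangement `d` of α has x^α in
-- its monomial function, and |d| = |α| keeps it within the bound `N`. The surviving term is X d,
-- whence the invariance required of `X`.
∑-partsUpTo-mS : ∀ N α (X : List ℕ → ℚ) → (∀ {β γ} → β ↭ γ → X β ≡ X γ) → sum α ≤ N →
  ∑ (partsUpTo (length α) N) (λ μ → mS μ α * X μ) ≡ X α
∑-partsUpTo-mS N α X X-↭ |α|≤N = begin
  ∑ (partsUpTo (length α) N) (λ μ → mS μ α * X μ)
    ≡⟨ ∑-filterB q (below (replicate (length α) N)) _ ⟩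
  ∑ (below (replicate (length α) N)) (λ μ → χ (q μ) * (mS μ α * X μ))
    ≡⟨ ∑-cong-All (below-length (replicate (length α) N))
         (λ μ |μ|≡ → term μ (trans |μ|≡ (Listₚ.length-replicate (length α)))) ⟩
  ∑ (below (replicate (length α) N)) (λ μ → δ d μ * X α)
    ≡⟨ ∑-*ʳ (below (replicate (length α) N)) (X α) (δ d) ⟩
  ∑ (below (replicate (length α) N)) (δ d) * X α
    ≡⟨ cong (λ k → ∑ (below (replicate k N)) (δ d) * X α) (sym (Permₚ.↭-length d↭α)) ⟩
  ∑ (below (replicate (length d) N)) (δ d) * X α
    ≡⟨ cong (_* X α) (∑-below-δ (All.map (λ x≤ → ℕₚ.≤-trans x≤ |d|≤N) (all≤sum d))) ⟩
  1ℚ * X α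
    ≡⟨ ℚₚ.*-identityˡ (X α) ⟩
  X α ∎
  where
  q : List ℕ → Bool
  q μ = decreasing μ ∧ (sum μ ≤ᵇ N)
  d : List ℕ
  d = Decreasing.sort α
  d↭α : d ↭ α
  d↭α = Decreasing.sort-↭ α
  |d|≤N : sum d ≤ N
  |d|≤N = subst (_≤ N) (sym (sum-↭ d↭α)) |α|≤N
  q-d : q d ≡ true
  q-d = cong₂ _∧_ (Linked⇒decreasing (Decreasing.sort-↗ α)) (≤⇒≤ᵇ-true |d|≤N)
  mS-d : mS d α ≡ 1ℚ
  mS-d with mS-support d α
  ... | inj₁ (eq , _) = eq
  ... | inj₂ (_ , ¬p) = contradiction (filterB-nonzero-↭ (Perm.↭-sym d↭α)) ¬p
  vanish : ∀ μ → length μ ≡ length α → (d ≡ μ → ⊥) → χ (q μ) * (mS μ α * X μ) ≡ 0ℚ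
  vanish μ |μ|≡|α| d≢μ with q μ in eq
  ... | false = ℚₚ.*-zeroˡ (mS μ α * X μ)
  ... | true  with mS-support μ α
  ...   | inj₂ (mS≡0 , _) = trans (ℚₚ.*-identityˡ _) (trans (cong (_* X μ) mS≡0) (ℚₚ.*-zeroˡ (X μ)))
  ...   | inj₁ (_ , p) = contradiction
    (Pointwise-≡⇒≡ (↗↭↗⇒≋ (DecTotalOrder.totalOrder ≥-decTotalOrder) (Decreasing.sort-↗ α)
      (decreasing⇒Linked μ (proj₁ (∧-true (decreasing μ) (sum μ ≤ᵇ N) eq)))
      (Perm.↭⇒↭ₛ (Perm.trans d↭α (nonzero-↭⇒↭ α μ (sym |μ|≡|α|) p)))))
    d≢μ
  term : ∀ μ → length μ ≡ length α → χ (q μ) * (mS μ α * X μ) ≡ δ d μ * X α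
  term μ |μ|≡|α| with Listₚ.≡-dec ℕₚ._≟_ d μ
  ... | no d≢μ   = trans (vanish μ |μ|≡|α| d≢μ)
    (sym (trans (cong (_* X α) (δ-≢ d μ d≢μ)) (ℚₚ.*-zeroˡ (X α))))
  ... | yes refl = begin
    χ (q d) * (mS d α * X d) ≡⟨ cong₂ _*_ (cong χ q-d) (cong₂ _*_ mS-d (X-↭ d↭α)) ⟩
    1ℚ * (1ℚ * X α)          ≡⟨ ℚₚ.*-identityˡ (1ℚ * X α) ⟩
    1ℚ * X α                 ≡⟨ cong (_* X α) (sym (δ-refl d)) ⟩
    δ d d * X α              ∎

-- The partial sums

gProd-↭ : ∀ s {α β} → α ↭ β → gProd s α ≈ gProd s β
gProd-↭ s Perm.refl       ν = refl
gProd-↭ s (prep x p)      ν = ⊛-cong (≈-refl {gS s x}) (gProd-↭ s p) ν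
gProd-↭ s (swap {xs = α} {ys = β} x y p) ν = trans
  (⊛ₚ.x∙yz≈y∙xz (gS s x) (gS s y) (gProd s α) ν)
  (⊛-cong (≈-refl {gS s y}) (⊛-cong (≈-refl {gS s x}) (gProd-↭ s p)) ν)
gProd-↭ s (Perm.trans p q) ν = trans (gProd-↭ s p ν) (gProd-↭ s q ν)

-- The common core of both halves. By `gProd-const-comm` the hypothesis on `T` says that T μ is the
-- sum over α + β = la of [x^α] m_μ times the product for β. After exchanging the sums, each α
-- selects one μ, and `gProd-suc` finishes.
∑-partsUpTo : ∀ b la N (T : List ℕ → Sym) → sum la ≤ N →
  (∀ μ ν → T μ ν ≡ (mS μ ⊛ gProd (const b) ν) la) → ∀ ν →
  ∑ (partsUpTo (length la) N)
    (λ μ → signℚ (sum μ) * (gProd (const (not b)) (map suc μ) ⊛ T μ) ν) ≡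
  gProd (const b) (map suc la) ν
∑-partsUpTo b la N T |la|≤N T≡ ν = begin
  ∑ (partsUpTo (length la) N) (λ μ → signℚ (sum μ) * (G μ ⊛ T μ) ν)
    ≡⟨ ∑-cong (partsUpTo (length la) N) expand ⟩
  ∑ (partsUpTo (length la) N) (λ μ → ∑ (splits la) (λ (α , β) → mS μ α * X β μ))
    ≡⟨ ∑-swap (partsUpTo (length la) N) (splits la) _ ⟩
  ∑ (splits la) (λ (α , β) → ∑ (partsUpTo (length la) N) (λ μ → mS μ α * X β μ))
    ≡⟨ ∑-cong-All (splits-IsSplit la) (λ (α , β) (|α|≡ , α+β≡) → trans
         (cong (λ k → ∑ (partsUpTo k N) (λ μ → mS μ α * X β μ)) (sym |α|≡))
         (∑-partsUpTo-mS N α (X β) (X-↭ β)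
           (ℕₚ.≤-trans (ℕₚ.≤-trans (ℕₚ.m≤m+n (sum α) (sum β)) (ℕₚ.≤-reflexive α+β≡)) |la|≤N))) ⟩
  ∑ (splits la) (λ (α , β) → X β α)
    ≡⟨ gProd-suc (const b) la ν ⟩
  gProd (const b) (map suc la) ν ∎
  where
  G : List ℕ → Sym
  G μ = gProd (const (not b)) (map suc μ)
  X : List ℕ → List ℕ → ℚ
  X β μ = signℚ (sum μ) * (G μ ⊛ gProd (const b) β) ν
  X-↭ : ∀ β {μ μ′} → μ ↭ μ′ → X β μ ≡ X β μ′
  X-↭ β p = cong₂ _*_ (cong signℚ (sum-↭ p))
    (⊛-cong (gProd-↭ (const (not b)) (Permₚ.map⁺ suc p)) (≈-refl {gProd (const b) β}) ν)
  T-splits : ∀ μ → T μ ≈ λ ρ → ∑ (splits la) (λ (α , β) → mS μ α * gProd (const b) β ρ)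
  T-splits μ ρ = trans (T≡ μ ρ) (trans (⊛-splits (mS μ) (gProd (const b) ρ) la)
    (∑-cong (splits la) (λ (α , β) → cong (mS μ α *_) (gProd-const-comm b ρ β))))
  expand : ∀ μ → signℚ (sum μ) * (G μ ⊛ T μ) ν ≡ ∑ (splits la) (λ (α , β) → mS μ α * X β μ)
  expand μ = begin
    signℚ (sum μ) * (G μ ⊛ T μ) ν
      ≡⟨ cong (signℚ (sum μ) *_) (trans (⊛-cong (≈-refl {G μ}) (T-splits μ) ν)
           (⊛-∑ʳ (splits la) (G μ) (λ (α , β) → scale (mS μ α) (gProd (const b) β)) ν)) ⟩
    signℚ (sum μ) * ∑ (splits la) (λ (α , β) → (G μ ⊛ scale (mS μ α) (gProd (const b) β)) ν)
      ≡⟨ sym (∑-*ˡ (splits la) (signℚ (sum μ)) _) ⟩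
    ∑ (splits la) (λ (α , β) → signℚ (sum μ) * (G μ ⊛ scale (mS μ α) (gProd (const b) β)) ν)
      ≡⟨ ∑-cong (splits la) (λ (α , β) → trans
           (cong (signℚ (sum μ) *_) (⊛-scaleʳ (mS μ α) (G μ) (gProd (const b) β) ν))
           (*ₚ.x∙yz≈y∙xz (signℚ (sum μ)) (mS μ α) _)) ⟩
    ∑ (splits la) (λ (α , β) → mS μ α * X β μ) ∎

sumS-∑ : ∀ (xs : List A) (F : A → Sym) ν → sumS (map F xs) ν ≡ ∑ xs (λ x → F x ν)
sumS-∑ []       F ν = sym (∑-[] _)
sumS-∑ (x ∷ xs) F ν = trans (cong (F x ν +_) (sumS-∑ xs F ν)) (sym (∑-∷ x xs _))

gProd-zeros : ∀ s m → gProd s (replicate m 0) ≈ oneS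
gProd-zeros s zero    ν = refl
gProd-zeros s (suc m) ν = trans (⊛-cong (gS-0 s) (gProd-zeros s m) ν) (⊛-identityˡ oneS ν)

gProd-padTo : ∀ s k la → gProd s (padTo k la) ≈ gProd s la
gProd-padTo s k la ν = trans (gProd-++ s la (replicate (k ∸ length la) 0) ν)
  (trans (⊛-cong (≈-refl {gProd s la}) (gProd-zeros s (k ∸ length la)) ν)
    (trans (⊛-comm (gProd s la) oneS ν) (⊛-identityˡ (gProd s la) ν)))

length-padTo : ∀ k la → length la ≤ k → length (padTo k la) ≡ k
length-padTo k la l≤k = trans (Listₚ.length-++ la)
  (trans (cong (length la ℕ.+_) (Listₚ.length-replicate (k ∸ length la))) (ℕₚ.m+[n∸m]≡n l≤k))

sum-padTo : ∀ k la → sum (padTo k la) ≡ sum la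
sum-padTo k la = trans (sum-++ la (replicate (k ∸ length la) 0))
  (trans (cong (sum la ℕ.+_) (sum-zeros (k ∸ length la))) (ℕₚ.+-identityʳ (sum la)))
  where
  sum-zeros : ∀ m → sum (replicate m 0) ≡ 0
  sum-zeros zero    = refl
  sum-zeros (suc m) = sum-zeros m

-- Pairing with h_la′ reads the coefficient at la′. The freedom in la′ serves the zero padding,
-- which changes the list but, as h_0 = 1, not the function.
monomialPerp-hProd : ∀ μ la {P} → IsPerp (mS μ) (hProd la) P → ∀ la′ → hProd la′ ≈ hProd la →
  ∀ ν → P ν ≡ (mS μ ⊛ gProd (const false) ν) la′
monomialPerp-hProd μ la perp la′ la′≈la ν = trans
  (perp-coefficient (mS μ) (hProd la) perp ((1ℚ , la′) ∷ []) (λ ρ → trans (toSym-singleton la′ ρ) (la′≈la ρ)) ν)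
  (trans (inner-singleton la′ (mS μ ⊛ hProd ν))
    (⊛-cong (≈-refl {mS μ}) (λ ρ → sym (gProd-false ν ρ)) la′))

-- If m_μ = Σ c h_κ then f_μ = Σ c e_κ. For each κ, `inner-eComb` turns the pairing of e_la′ with
-- e_κ h_ν into the coefficient of h_κ e_ν at la′, and summing over κ reassembles m_μ.
forgottenPerp-eProd : ∀ μ la {f Q} → IsOmega (mS μ) f → IsPerp f (eProd la) Q →
  ∀ la′ → eProd la′ ≈ eProd la → ∀ ν → Q ν ≡ (mS μ ⊛ gProd (const true) ν) la′
forgottenPerp-eProd μ la {f} {Q} f-omega perp la′ la′≈la ν = begin
  Q ν
    ≡⟨ perp-coefficient f (eProd la) perp (eComb la′) eComb≈ ν ⟩
  inner (eComb la′) (f ⊛ hProd ν)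
    ≡⟨ inner-cong (eComb la′) (λ ρ → trans (⊛-cong f≈ (≈-refl {hProd ν}) ρ)
         (trans (⊛-∑ˡ H (λ (c , κ) → scale c (eProd κ)) (hProd ν) ρ)
           (∑-cong H (λ (c , κ) → ⊛-scaleˡ c (eProd κ) (hProd ν) ρ)))) ⟩
  inner (eComb la′) (λ ρ → ∑ H (λ (c , κ) → c * (eProd κ ⊛ hProd ν) ρ))
    ≡⟨ inner-∑ʳ (eComb la′) ⟩
  ∑ H (λ (c , κ) → c * inner (eComb la′) (eProd κ ⊛ hProd ν))
    ≡⟨ ∑-cong H (λ (c , κ) → trans (cong (c *_) (inner-eComb la′ κ ν))
         (sym (⊛-scaleˡ c (hProd κ) (eProd ν) la′))) ⟩
  ∑ H (λ (c , κ) → (scale c (hProd κ) ⊛ eProd ν) la′)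
    ≡⟨ sym (⊛-∑ˡ H (λ (c , κ) → scale c (hProd κ)) (eProd ν) la′) ⟩
  ((λ ρ → ∑ H (λ (c , κ) → c * hProd κ ρ)) ⊛ eProd ν) la′
    ≡⟨ ⊛-cong (λ ρ → trans (sym (toSym-∑ H ρ)) (H≈mS ρ)) (λ ρ → sym (gProd-true ν ρ)) la′ ⟩
  (mS μ ⊛ gProd (const true) ν) la′ ∎
  where
  H = proj₁ (monomialComb μ)
  H≈mS = proj₂ (monomialComb μ)
  toSym-∑ : ∀ H ρ → toSym H ρ ≡ ∑ H (λ (c , κ) → c * hProd κ ρ)
  toSym-∑ H ρ = trans (sym (∑≡sumℚ H _)) (∑-cong H (λ _ → refl))
  f≈ : f ≈ λ ρ → ∑ H (λ (c , κ) → c * eProd κ ρ)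
  f≈ ρ = trans (sym (f-omega H H≈mS ρ)) (trans (sym (∑≡sumℚ H _)) (∑-cong H (λ _ → refl)))
  eComb≈ : toSym (eComb la′) ≈ eProd la
  eComb≈ ρ = trans (toSym-evalS (eComb la′) ρ)
    (trans (evalS-eComb la′ (const false) ρ) (trans (gProd-true la′ ρ) (la′≈la ρ)))
  inner-∑ʳ : ∀ K → inner K (λ ρ → ∑ H (λ (c , κ) → c * (eProd κ ⊛ hProd ν) ρ)) ≡
    ∑ H (λ (c , κ) → c * inner K (eProd κ ⊛ hProd ν))
  inner-∑ʳ K = begin
    inner K (λ ρ → ∑ H (λ (c , κ) → c * (eProd κ ⊛ hProd ν) ρ))
      ≡⟨ inner-∑ K _ ⟩
    ∑ K (λ (d , ρ) → d * ∑ H (λ (c , κ) → c * (eProd κ ⊛ hProd ν) ρ))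
      ≡⟨ ∑-cong K (λ (d , ρ) → trans (sym (∑-*ˡ H d _))
           (∑-cong H (λ (c , κ) → *ₚ.x∙yz≈y∙xz d c ((eProd κ ⊛ hProd ν) ρ)))) ⟩
    ∑ K (λ (d , ρ) → ∑ H (λ (c , κ) → c * (d * (eProd κ ⊛ hProd ν) ρ)))
      ≡⟨ ∑-swap K H _ ⟩
    ∑ H (λ (c , κ) → ∑ K (λ (d , ρ) → c * (d * (eProd κ ⊛ hProd ν) ρ)))
      ≡⟨ ∑-cong H (λ (c , κ) → trans (∑-*ˡ K c _)
           (cong (c *_) (sym (inner-∑ K (eProd κ ⊛ hProd ν))))) ⟩
    ∑ H (λ (c , κ) → c * inner K (eProd κ ⊛ hProd ν)) ∎

-- The infinite sums are rendered by their truncations at size `N`, all of which have the asserted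
-- value as soon as N ≥ |la|.
mainTheorem2 : (k : ℕ) (la : List ℕ) → IsPartition la → length la ≤ k →
  (N : ℕ) → sum la ≤ N →
  ((P : List ℕ → Sym) → (∀ μ → IsPerp (mS μ) (hProd la) (P μ)) →
     CHpartial k N P ≈ hProd (plus1k k la))
  ×
  ((f Q : List ℕ → Sym) → (∀ μ → IsOmega (mS μ) (f μ)) →
     (∀ μ → IsPerp (f μ) (eProd la) (Q μ)) →
     CEpartial k N Q ≈ eProd (plus1k k la))
mainTheorem2 k la _ l≤k N |la|≤N = CH , CE
  where
  -- The splits of the padded list have `k` entries, like the lists of `partsUpTo k N`. Each added
  -- zero accounts for one factor h_1 or e_1 of the result.
  la′ = padTo k la

  partial : ∀ b T → (∀ μ ν → T μ ν ≡ (mS μ ⊛ gProd (const b) ν) la′) → ∀ ν →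
    ∑ (partsUpTo k N) (λ μ → signℚ (sum μ) * (gProd (const (not b)) (map suc μ) ⊛ T μ) ν) ≡
    gProd (const b) (map suc la′) ν
  partial b T T≡ ν = trans
    (cong (λ m → ∑ (partsUpTo m N)
        (λ μ → signℚ (sum μ) * (gProd (const (not b)) (map suc μ) ⊛ T μ) ν))
      (sym (length-padTo k la l≤k)))
    (∑-partsUpTo b la′ N T (subst (_≤ N) (sym (sum-padTo k la)) |la|≤N) T≡ ν)

  pad : ∀ s {F : List ℕ → Sym} → (∀ μ → gProd s μ ≈ F μ) → F la′ ≈ F la
  pad s gProd≈F ν =
    trans (sym (gProd≈F la′ ν)) (trans (gProd-padTo s k la ν) (gProd≈F la ν))

  CH : ∀ P → (∀ μ → IsPerp (mS μ) (hProd la) (P μ)) → CHpartial k N P ≈ hProd (plus1k k la)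
  CH P perp ν = begin
    CHpartial k N P ν
      ≡⟨ sumS-∑ (partsUpTo k N) _ ν ⟩
    ∑ (partsUpTo k N) (λ μ → signℚ (sum μ) * (eProd (map suc μ) ⊛ P μ) ν)
      ≡⟨ ∑-cong (partsUpTo k N) (λ μ → cong (signℚ (sum μ) *_)
           (⊛-cong (λ ρ → sym (gProd-true (map suc μ) ρ)) (≈-refl {P μ}) ν)) ⟩
    ∑ (partsUpTo k N) (λ μ → signℚ (sum μ) * (gProd (const true) (map suc μ) ⊛ P μ) ν)
      ≡⟨ partial false P
           (λ μ → monomialPerp-hProd μ la (perp μ) la′ (pad (const false) gProd-false)) ν ⟩
    gProd (const false) (plus1k k la) ν
      ≡⟨ gProd-false (plus1k k la) ν ⟩
    hProd (plus1k k la) ν ∎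

  CE : ∀ f Q → (∀ μ → IsOmega (mS μ) (f μ)) → (∀ μ → IsPerp (f μ) (eProd la) (Q μ)) →
       CEpartial k N Q ≈ eProd (plus1k k la)
  CE f Q omega perp ν = begin
    CEpartial k N Q ν
      ≡⟨ sumS-∑ (partsUpTo k N) _ ν ⟩
    ∑ (partsUpTo k N) (λ μ → signℚ (sum μ) * (hProd (map suc μ) ⊛ Q μ) ν)
      ≡⟨ ∑-cong (partsUpTo k N) (λ μ → cong (signℚ (sum μ) *_)
           (⊛-cong (λ ρ → sym (gProd-false (map suc μ) ρ)) (≈-refl {Q μ}) ν)) ⟩
    ∑ (partsUpTo k N) (λ μ → signℚ (sum μ) * (gProd (const false) (map suc μ) ⊛ Q μ) ν)
      ≡⟨ partial true Q
           (λ μ → forgottenPerp-eProd μ la (omega μ) (perp μ) la′ (pad (const true) gProd-true)) ν ⟩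
    gProd (const true) (plus1k k la) ν
      ≡⟨ gProd-true (plus1k k la) ν ⟩
    eProd (plus1k k la) ν ∎
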